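{- For every integer $n\geq 1$, \[ \mathrm{lcm}\big\{\mathrm{denom}(\mathrm{coeff}(w,H)) : w\in\{\mathtt{A},\mathtt{B}\}^n\big\} = n!\,d_n , \] i.e. $n!\,d_n$ is the smallest common denominator of the coefficients of all words of length $n$ in the Baker--Campbell--Hausdorff series $H$.
   Context: Let $\mathbb{Q}\langle\langle \mathtt{A},\mathtt{B}\rangle\rangle$ be the ring of formal power series in the non-commuting variables $\mathtt{A},\mathtt{B}$ with rational coefficients. The Baker--Campbell--Hausdorff series is \[ H=\log(e^{\mathtt{A}}e^{\mathtt{B}})=\sum_{k\geq 1}\frac{(-1)^{k+1}}{k}\Big(\sum_{i+j>0}\frac{1}{i!\,j!}\mathtt{A}^i\mathtt{B}^j\Big)^k . \] For a word $w$, $\mathrm{coeff}(w,H)$ denotes the coefficient of $w$ in $H$. $\{\mathtt{A},\mathtt{B}\}^n$ denotes the set of words of length $n$ over the alphabet $\{\mathtt{A},\mathtt{B}\}$. For $r\in\mathbb{Q}$, $\mathrm{denom}(r)$ is the smallest positive integer $d$ with $rd\in\mathbb{Z}$ (so $\mathrm{denom}(0)=1$), and $\mathrm{lcm}$ is the least common multiple of a finite set of integers. For a prime $p$ and $n\geq1$ with $p$-adic expansion $n=\alpha_0+\alpha_1p+\dots+\alpha_rp^r$, $0\le\alpha_i\le p-1$, let $s_p(n)=\alpha_0+\dots+\alpha_r$ and $l(n,p)=\max\{t : p^t\le s_p(n)\}=\lfloor \log_p s_p(n)\rfloor$. Define $d_n=\prod_{p \text{ prime},\, p<n} p^{l(n,p)}$.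 -}

module Defs where

open import Data.Nat as ℕ using (ℕ; zero; suc; _!; _^_; _≤?_; NonZero)
open import Data.Nat.Properties using (_!*_!≢0)
open import Data.Nat.DivMod using (_%_; _/_)
open import Data.Nat.LCM using (lcm)
open import Data.Nat.Primality using (prime?)
open import Data.Integer as ℤ using (ℤ; +_)
open import Data.Rational as ℚ using (ℚ; 0ℚ; 1ℚ)
open import Data.List using (List; []; _∷_; map; foldr; filter; concatMap; length; upTo; applyUpTo)
open import Data.Bool using (Bool; true; false; if_then_else_)
open import Data.Product using (_×_; _,_)

data Letter : Set where
  A B : Letter

Word : Set
Word = List Letter

wordsOfLength : ℕ → List Word
wordsOfLength zero    = [] ∷ []
wordsOfLength (suc n) = concatMap (λ w → (A ∷ w) ∷ (B ∷ w) ∷ []) (wordsOfLength n)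

-- Formal power series in non-commuting A, B with rational coefficients,
-- represented by their coefficient function  Word → ℚ.

Series : Set
Series = Word → ℚ

sumℚ : List ℚ → ℚ
sumℚ = foldr ℚ._+_ 0ℚ

splits : Word → List (Word × Word)
splits []      = ([] , []) ∷ []
splits (x ∷ w) = ([] , x ∷ w) ∷ map (λ { (u , v) → (x ∷ u , v) }) (splits w)

_⊛_ : Series → Series → Series
(f ⊛ g) w = sumℚ (map (λ { (u , v) → f u ℚ.* g v }) (splits w))

oneS : Series
oneS []      = 1ℚ
oneS (_ ∷ _) = 0ℚ

_^S_ : Series → ℕ → Series
f ^S zero  = oneS
f ^S suc k = f ⊛ (f ^S k)

-- coefficient of A^i B^j (i+j>0) in  X = Σ_{i+j>0} A^i B^j / (i! j!)
-- i.e. X = e^A e^B − 1.  Returns 1/(i! j!) if w = A^i B^j, w ≠ [], else 0.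
coeffBs : ℕ → Word → ℚ          -- w should be B^j; first arg is i
coeffBs i []      = ℤ.+ 1 ℚ./ (i ! ℕ.* 0 !)
  where instance _ = i !* 0 !≢0
coeffBs i (A ∷ w) = 0ℚ
coeffBs i (B ∷ w) = go 1 w
  where
  go : ℕ → Word → ℚ
  go j []      = ℤ.+ 1 ℚ./ (i ! ℕ.* j !)
    where instance _ = i !* j !≢0
  go j (A ∷ _) = 0ℚ
  go j (B ∷ v) = go (suc j) v

coeffAs : ℕ → Word → ℚ
coeffAs i []      = if i ℕ.≡ᵇ 0 then 0ℚ else coeffBs i []
coeffAs i (A ∷ w) = coeffAs (suc i) w
coeffAs i (B ∷ w) = coeffBs i (B ∷ w)

X : Series
X = coeffAs 0

-- H = log(e^A e^B) = Σ_{k≥1} (-1)^{k+1}/k · X^k.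
-- Since X has zero constant term, X^k contributes nothing to words of
-- length < k, so the coefficient of w only involves k = 1 … |w|.
-- (-1)^(k+1) for k ≥ 0 (we only use k ≥ 1)
sign : ℕ → ℚ
sign zero    = ℚ.- 1ℚ
sign (suc k) = ℚ.- sign k

logCoeff : (k : ℕ) → .{{NonZero k}} → ℚ
logCoeff k = sign k ℚ.* (ℤ.+ 1 ℚ./ k)

H : Series
H w = sumℚ (map (λ k → logCoeff (suc k) ℚ.* (X ^S suc k) w) (upTo (length w)))

coeff : Word → Series → ℚ
coeff w f = f w

denom : ℚ → ℕ
denom = ℚ.ℚ.denominatorℕ

lcmList : List ℕ → ℕ
lcmList = foldr lcm 1

-- s_p(n): sum of base-p digits of n (fuel-bounded recursion; fuel n suffices
-- since n / p < n for p ≥ 2, n ≥ 1).  Only used for primes p.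
digitSumFuel : ℕ → (p : ℕ) → .{{NonZero p}} → ℕ → ℕ
digitSumFuel zero     p m = 0
digitSumFuel (suc f)  p zero = 0
digitSumFuel (suc f)  p (suc m) = (suc m % p) ℕ.+ digitSumFuel f p (suc m / p)

s : (p : ℕ) → .{{NonZero p}} → ℕ → ℕ
s p n = digitSumFuel n p n

-- l(n,p) = max { t : p^t ≤ s_p(n) }  (t ranges over 0 … s_p(n), which
-- contains every such t since p^t ≥ t+1 > s for t > s when p ≥ 2)
l : ℕ → (p : ℕ) → .{{NonZero p}} → ℕ
l n p = foldr ℕ._⊔_ 0 (filter (λ t → p ^ t ≤? s p n) (upTo (suc (s p n))))

primesBelow : ℕ → List ℕ
primesBelow n = filter prime? (upTo n)

primePowFactor : ℕ → ℕ → ℕ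
primePowFactor n zero    = 1
primePowFactor n (suc q) = suc q ^ l n (suc q)

d : ℕ → ℕ
d n = foldr ℕ._*_ 1 (map (primePowFactor n) (primesBelow n))

bchDenomLcm : ℕ → ℕ
bchDenomLcm n = lcmList (map (λ w → denom (coeff w H)) (wordsOfLength n))

{-# OPTIONS --safe #-}

-- The coefficient of w in X ^ k is a sum of products of 1 / (i ! j !), one factor for each of k nonempty
-- pieces A^i B^j of w.  By Legendre's formula (p − 1) v_p(n !) = n − s_p(n), each factor i ! j ! has
-- p-adic valuation at most (i + j − 1) / (p − 1), so n ! times that coefficient is divisible by p ^ e as soon as
-- s_p(n) + (p − 1)(e − 1) < k.  As s_p(n) < p ^ (l + 1) for l = l(n, p), this outweighs the denominator k of the
-- logarithm up to a factor p ^ l, term by term; hence n ! dₙ is a common denominator.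
--
-- It is attained at each prime p ≤ n by an alternating word A^{q₁} B^{q₂} A^{q₃} … of m = p ^ λ + c blocks with
-- λ ≥ 1 and c ≤ p − 2, where q₂, q₃, … are powers of p and q₁ ≡ 1 modulo p − 1.  By Fermat's theorem the number
-- of surjections from a q₁-element set onto a j-element set vanishes modulo p for j ≥ 2, so modulo p the blocks
-- behave like single letters, and the coefficient in X ^ k, multiplied by ∏ qᵢ !, becomes ⌊ m /2⌋ C (m − k).
-- The block lengths add up to n with ε ∈ {0, 1} carries in base p, where λ = l + ε: ε = 1 exactly when
-- s_p(n) + p − 1 ≥ p ^ (l + 1), and then m = s_p(n) + p − 1.  This makes k = p ^ λ the only term of the
-- logarithm that reaches the full denominator, and ⌊ m /2⌋ C c is not divisible by p.
module Submission where

open import Defs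
open import Data.Integer as ℤ using (ℤ; +_; -[1+_])
import Data.Integer.Divisibility.Signed as ℤ∣
import Data.Integer.Properties as ℤ
import Data.Integer.Solver as ℤSolver
open import Data.List using (List; []; _∷_; _++_; applyUpTo; filter; foldr; length; map; replicate; upTo)
open import Data.List.Membership.Propositional using (_∈_; _∉_)
open import Data.List.Membership.Propositional.Properties
  using (∈-concatMap⁺; ∈-filter⁺; ∈-filter⁻; ∈-map⁺; ∈-upTo⁺; ∈-upTo⁻)
open import Data.List.Properties using (++-identityʳ; length-++; length-replicate; map-∘)
open import Data.List.Relation.Unary.All as All using (All; []; _∷_)
import Data.List.Relation.Unary.All.Properties as All
open import Data.List.Relation.Unary.AllPairs using ([]; _∷_)
open import Data.List.Relation.Unary.Any as Any using (here; there)
open import Data.List.Relation.Unary.Unique.Propositional using (Unique)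
import Data.List.Relation.Unary.Unique.Propositional.Properties as Unique
open import Data.Nat
open import Data.Nat.Combinatorics
  using (_C_; k![n∸k]!∣n!; k>n⇒nCk≡0; nCk+nC[k+1]≡[n+1]C[k+1]; nCk≡n!/k![n-k]!; nCn≡1)
import Data.Nat.Coprimality as Coprime
open import Data.Nat.Divisibility
open import Data.Nat.DivMod
  using (_/_; _%_; +-distrib-/-∣ʳ; /-congʳ; [m+kn]%n≡m%n; m%n<n; m*n%n≡0; m*n/n≡m; m/n*n≡m; m/n<m;
         m<n⇒m%n≡m; m<n⇒m/n≡0; m≡m%n+[m/n]*n)
open import Data.Nat.GCD using (gcd; gcd[m,n]∣m; gcd[m,n]∣n; gcd[m,n]≢0)
open import Data.Nat.Induction using (<-rec)
open import Data.Nat.LCM using (lcm-least; m∣lcm[m,n]; n∣lcm[m,n])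
open import Data.Nat.ListAction using (product; sum)
open import Data.Nat.Primality
open import Data.Nat.Primality.Factorisation using (factorise)
open import Data.Nat.Properties
open import Data.Nat.Solver using (module +-*-Solver)
open import Data.Product using (∃; ∃₂; _×_; _,_; proj₁; proj₂)
open import Data.Rational as ℚ using (ℚ; 0ℚ; 1ℚ; mkℚ; toℚᵘ)
import Data.Rational.Properties as ℚ
open import Data.Rational.Solver using () renaming (module +-*-Solver to ℚSolver)
open import Data.Rational.Unnormalised as ℚᵘ using (mkℚᵘ; *≡*)
import Data.Rational.Unnormalised.Properties as ℚᵘ
open import Data.Sum using (_⊎_; inj₁; inj₂; [_,_]′)
open import Function using (_∘_; id)
open import Relation.Binary.Definitions using (tri<; tri≈; tri>)
open import Relation.Binary.PropositionalEquality
open import Relation.Nullary using (¬_; yes; no; contradiction)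
open import Relation.Unary using (Decidable; Pred)

-- The proof works at one prime p at a time, and `∣-local-global` reassembles the primes. Each term
-- of the logarithm is a balance of powers of p: `d n` supplies l, the coefficient of X ^ k supplies
-- some, and 1 / k takes v_p(k). Two normalisations of that coefficient serve different ends.
-- Multiplication by n ! suits all words at once, since peeling off one factor X produces a binomial
-- coefficient whose carries can be counted. Multiplication by the factorials of the runs gives an
-- integer `F` that can be computed modulo p. Up to factors prime to p, the two differ by p ^ ε. The
-- dichotomy for ε originates in the terms where p ^ (λ + 1) divides k. The general bound makes them
-- negligible if s_p(n) + (p - 1)(1 + ε) < p ^ (λ + 1). For ε = 0, where λ = l, this can fail; one
-- deliberate carry then raises λ to l + 1 and with it the right side by a factor p. The range 0 ≤ c
-- ≤ p - 2 meets every residue modulo p - 1, which is the freedom that makes q₁ ≡ 1 possible.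

-- Digit sums in base p

module DigitSum (q : ℕ) where

  p : ℕ
  p = 2 + q

  -- Division by p lowers every positive number, so fuel m already reaches 0; the fuel in the
  -- definition of `s` can then be forgotten.
  digitSumFuel-stable : ∀ f g m → m ≤ f → m ≤ g → digitSumFuel f p m ≡ digitSumFuel g p m
  digitSumFuel-stable zero    zero    m       _ _ = refl
  digitSumFuel-stable zero    (suc g) zero    _ _ = refl
  digitSumFuel-stable (suc f) zero    zero    _ _ = refl
  digitSumFuel-stable (suc f) (suc g) zero    _ _ = refl
  digitSumFuel-stable (suc f) (suc g) (suc m) (s≤s m≤f) (s≤s m≤g) =
    cong (λ z → suc m % p + z) (digitSumFuel-stable f g (suc m / p) (≤-trans small m≤f) (≤-trans small m≤g))
    where
    small : suc m / p ≤ m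
    small = ≤-pred (m/n<m (suc m) p (s≤s (s≤s z≤n)))

  s-step : ∀ k → s p (suc k) ≡ suc k % p + s p (suc k / p)
  s-step k = cong (λ z → suc k % p + z)
    (digitSumFuel-stable k (suc k / p) (suc k / p) (≤-pred (m/n<m (suc k) p (s≤s (s≤s z≤n)))) ≤-refl)

  s-digit : ∀ r m → r < p → s p (r + m * p) ≡ r + s p m
  s-digit zero    zero    _   = refl
  s-digit zero    m@(suc m′) _ = trans (s-step (suc (q + m′ * p)))
      (cong₂ _+_ (m*n%n≡0 m p) (cong (s p) (m*n/n≡m m p)))
  s-digit r@(suc r′) m r<p = trans (s-step (r′ + m * p)) (cong₂ _+_ remainder (cong (s p) quotient′))
    where
    remainder : (r + m * p) % p ≡ r
    remainder = trans ([m+kn]%n≡m%n r m p) (m<n⇒m%n≡m r<p)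
    quotient′ : (r + m * p) / p ≡ m
    quotient′ = trans (+-distrib-/-∣ʳ r (n∣m*n m)) (cong₂ _+_ (m<n⇒m/n≡0 r<p) (m*n/n≡m m p))

  data Digits : ℕ → Set where
    digits : ∀ r m → r < p → Digits (r + m * p)

  toDigits : ∀ n → Digits n
  toDigits n = subst Digits (sym (m≡m%n+[m/n]*n n p)) (digits (n % p) (n / p) (m%n<n n p))

  m<digits : ∀ r m → 0 < r + m * p → m < r + m * p
  m<digits (suc r) m _ = s≤s (≤-trans (m≤m*n m p) (m≤n+m (m * p) r))
  m<digits zero (suc m) _ = s≤s (s≤s (≤-trans (m≤m*n m p) (m≤n+m (m * p) q)))

  -- v is also the number of carries when 1 is added to n in base p.
  s-suc : ∀ n → ∃₂ λ v u → ¬ (p ∣ u) × suc n ≡ p ^ v * u × suc (s p n) ≡ s p (suc n) + suc q * v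
  s-suc = <-rec _ go
    where
    go : ∀ n → (∀ {m} → m < n → ∃₂ λ v u → ¬ (p ∣ u) × suc m ≡ p ^ v * u × suc (s p m) ≡ s p (suc m) + suc q * v)
       → ∃₂ λ v u → ¬ (p ∣ u) × suc n ≡ p ^ v * u × suc (s p n) ≡ s p (suc n) + suc q * v
    go n rec with toDigits n
    go _ rec | digits r m r<p with suc r <? p
    ... | yes 1+r<p = 0 , suc (r + m * p) , p∤ , sym (+-identityʳ _)
        , trans (cong suc (s-digit r m r<p))
            (trans (sym (s-digit (suc r) m 1+r<p)) (sym
                (trans (cong (λ z → s p (suc r + m * p) + z) (*-zeroʳ (suc q))) (+-identityʳ _))))
      where
      p∤ : ¬ (p ∣ suc r + m * p)
      p∤ d = 1+n≰n (≤-trans (∣⇒≤ (∣m+n∣m⇒∣n (subst (p ∣_) (+-comm (suc r) (m * p)) d) (n∣m*n m))) (≤-pred 1+r<p))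
    -- The last digit is p - 1: it turns to 0, and the carry into m yields one factor p and costs p
    -- - 1 in the digit sum.
    ... | no 1+r≮p with suc-injective (≤-antisym r<p (≮⇒≥ 1+r≮p))
    ... | refl with rec (m<digits (suc q) m (s≤s z≤n))
    ... | v , u , p∤u , eq , eqs = suc v , u , p∤u
        , trans (cong (_* p) eq) (solve 3 (λ a b c → a :* b :* c := c :* a :* b) refl (p ^ v) u p)
        , (begin
            suc (s p (suc q + m * p))          ≡⟨ cong suc (s-digit (suc q) m r<p) ⟩
            suc (suc q + s p m)                ≡⟨ sym (+-suc (suc q) (s p m)) ⟩
            suc q + suc (s p m)                ≡⟨ cong (λ z → suc q + z) eqs ⟩
            suc q + (s p (suc m) + suc q * v)  ≡⟨ solve 3
                (λ a b c → a :+ (b :+ a :* c) := b :+ a :* (con 1 :+ c)) refl (suc q) (s p (suc m)) v ⟩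
            s p (suc m) + suc q * suc v        ≡⟨ cong (_+ suc q * suc v) (sym (s-digit 0 (suc m) (s≤s z≤n))) ⟩
            s p (suc m * p) + suc q * suc v    ∎)
      where
      open ≡-Reasoning
      open +-*-Solver

  s-pow : ∀ a → s p (p ^ a) ≡ 1
  s-pow zero    = s-digit 1 0 (s≤s (s≤s z≤n))
  s-pow (suc a) = trans (cong (s p) (*-comm p (p ^ a))) (trans (s-digit 0 (p ^ a) (s≤s z≤n)) (s-pow a))

  s-small : ∀ n → n < p → s p n ≡ n
  s-small n n<p = trans (cong (s p) (sym (+-identityʳ n))) (trans (s-digit n 0 n<p) (+-identityʳ n))

  -- The unit is taken off the leading digit, so a > 0 as soon as n has two digits; `one-carry` can
  -- then break p ^ a into p equal powers.
  split-power : ∀ n → 0 < n → ∃₂ λ a m → n ≡ p ^ a + m × s p n ≡ suc (s p m) × (p ≤ n → 0 < a)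
  split-power = <-rec _ go
    where
    open +-*-Solver
    go : ∀ n → (∀ {k} → k < n → 0 < k → ∃₂ λ a m → k ≡ p ^ a + m × s p k ≡ suc (s p m) × (p ≤ k → 0 < a))
       → 0 < n → ∃₂ λ a m → n ≡ p ^ a + m × s p n ≡ suc (s p m) × (p ≤ n → 0 < a)
    go n rec 0<n with toDigits n
    go _ rec () | digits zero zero _
    go _ rec _ | digits (suc r) zero r<p = 0 , r , +-identityʳ (suc r)
      , trans (s-digit (suc r) 0 r<p) (trans (+-identityʳ _) (cong suc (sym (s-small r (<⇒≤ r<p)))))
      , λ p≤ → contradiction (≤-<-trans (≤-trans p≤ (≤-reflexive (+-identityʳ _))) r<p) 1+n≰n
    go _ rec 0<n | digits r (suc m) r<p with rec (m<digits r (suc m) 0<n) (s≤s z≤n)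
    ... | a , k , eq , eqs , _ = suc a , r + k * p
      , trans (cong (λ x → r + x * p) eq)
          (solve 4 (λ r x k p → r :+ (x :+ k) :* p := p :* x :+ (r :+ k :* p)) refl r (p ^ a) k p)
      , trans (s-digit r (suc m) r<p) (trans (cong (λ z → r + z) eqs)
          (trans (+-suc r _) (cong suc (sym (s-digit r k r<p)))))
      , λ _ → s≤s z≤n

  s-pos : ∀ n → 0 < n → 0 < s p n
  s-pos n 0<n with split-power n 0<n
  ... | _ , _ , _ , eq , _ = ≤-trans (s≤s z≤n) (≤-reflexive (sym eq))

-- Valuations and Legendre's formula

module PrimeValuation (q : ℕ) (pr : Prime (2 + q)) where
  open DigitSum q public

  ∤-* : ∀ {m n} → ¬ (p ∣ m) → ¬ (p ∣ n) → ¬ (p ∣ m * n)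
  ∤-* p∤m p∤n d = [ p∤m , p∤n ]′ (euclidsLemma _ _ pr d)

  p∤1 : ¬ (p ∣ 1)
  p∤1 d with ∣1⇒≡1 d
  ... | ()

  factor : ∀ k → 0 < k → ∃₂ λ v u → ¬ (p ∣ u) × k ≡ p ^ v * u
  factor (suc k) _ with s-suc k
  ... | v , u , p∤u , eq , _ = v , u , p∤u , eq

  pow∣-coprime : ∀ e {u k} → ¬ (p ∣ u) → p ^ e ∣ u * k → p ^ e ∣ k
  pow∣-coprime zero    p∤u d = 1∣ _
  pow∣-coprime (suc e) {u} {k} p∤u d with euclidsLemma u k pr (∣-trans (m∣m*n (p ^ e)) d)
  ... | inj₁ p∣u = contradiction p∣u p∤u
  ... | inj₂ (divides k′ refl) = subst (p ^ suc e ∣_) (*-comm p k′) (*-monoʳ-∣ p (pow∣-coprime e p∤u d′))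
    where
    open +-*-Solver
    d′ : p ^ e ∣ u * k′
    d′ = *-cancelˡ-∣ p (subst (p ^ suc e ∣_) (solve 3 (λ u k p → u :* (k :* p) := p :* (u :* k)) refl u k′ p) d)

  pow∣⇒≤ : ∀ e f {u} → ¬ (p ∣ u) → p ^ e ∣ p ^ f * u → e ≤ f
  pow∣⇒≤ zero    f       p∤u d = z≤n
  pow∣⇒≤ (suc e) zero    {u} p∤u d = contradiction
      (∣-trans (m∣m*n (p ^ e)) (subst (p ^ suc e ∣_) (+-identityʳ u) d)) p∤u
  pow∣⇒≤ (suc e) (suc f) {u} p∤u d = s≤s (pow∣⇒≤ e f p∤u
      (*-cancelˡ-∣ p (subst (p ^ suc e ∣_) (*-assoc p (p ^ f) u) d)))

  -- Induction on n: the valuation of suc n is the number of carries when 1 is added to n, and by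
  -- `s-suc` each of them lowers the digit sum by p - 1.
  legendre : ∀ n → ∃₂ λ v u → ¬ (p ∣ u) × n ! ≡ p ^ v * u × n ≡ s p n + suc q * v
  legendre zero    = 0 , 1 , p∤1 , refl , sym (*-zeroʳ (suc q))
  legendre (suc n) with legendre n | s-suc n
  ... | v , u , p∤u , eq , eqn | v′ , u′ , p∤u′ , eq′ , eqs′ = v′ + v , u′ * u , ∤-* p∤u′ p∤u
      , trans (cong₂ _*_ eq′ eq) (trans (solve 4 (λ a b c d → a :* b :* (c :* d) := a :* c :* (b :* d)) refl
          (p ^ v′) u′ (p ^ v) u)
          (cong (_* (u′ * u)) (sym (^-distribˡ-+-* p v′ v))))
      , trans (cong suc eqn) (trans (cong (_+ suc q * v) eqs′)
          (solve 4 (λ s q a b → s :+ q :* a :+ q :* b := s :+ q :* (a :+ b)) refl (s p (suc n)) (suc q) v′ v))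
      where open +-*-Solver

-- From local to global divisibility

prime∣ : ∀ n → .{{NonZero n}} → n ≢ 1 → ∃ λ p → Prime p × p ∣ n
prime∣ n n≢1 with factorise n
... | record { factors = [] ; isFactorisation = eq } = contradiction eq n≢1
... | record { factors = p ∷ ps ; isFactorisation = eq ; factorsPrime = pr ∷ _ } =
  p , pr , subst (p ∣_) (sym eq) (m∣m*n (product ps))

-- After division by the gcd, a′ is coprime to b′ and hence divides the multiplier u of every prime.
-- A prime factor of a′ would divide its own multiplier, so a′ = 1.
∣-local-global : ∀ a b → .{{NonZero a}} → (∀ p → Prime p → ∃ λ u → ¬ (p ∣ u) × a ∣ u * b) → a ∣ b
∣-local-global a b locally with a / g ≟ 1
  where
  g = gcd a b
  instance g≢0 = ≢-nonZero (gcd[m,n]≢0 a b (inj₁ (≢-nonZero⁻¹ a)))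
... | yes eq = subst (_∣ b) (trans (sym (*-identityˡ _))
    (trans (cong (_* gcd a b) (sym eq)) (m/n*n≡m (gcd[m,n]∣m a b)))) (gcd[m,n]∣n a b)
  where instance g≢0 = ≢-nonZero (gcd[m,n]≢0 a b (inj₁ (≢-nonZero⁻¹ a)))
... | no neq = contradiction a′∣u λ a′∣u → p∤u (∣-trans p∣a′ a′∣u)
  where
  g = gcd a b
  instance g≢0 = ≢-nonZero (gcd[m,n]≢0 a b (inj₁ (≢-nonZero⁻¹ a)))
  a′ b′ : ℕ
  a′ = a / g
  b′ = b / g
  a≡ : a′ * g ≡ a
  a≡ = m/n*n≡m (gcd[m,n]∣m a b)
  b≡ : b′ * g ≡ b
  b≡ = m/n*n≡m (gcd[m,n]∣n a b)
  instance a′≢0 = ≢-nonZero {a′} λ eq → ≢-nonZero⁻¹ a (trans (sym a≡) (cong (_* g) eq))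
  bad = prime∣ a′ neq
  p = proj₁ bad
  p∣a′ = proj₂ (proj₂ bad)
  loc = locally p (proj₁ (proj₂ bad))
  u = proj₁ loc
  p∤u = proj₁ (proj₂ loc)
  a′∣u : a′ ∣ u
  a′∣u = Coprime.coprime-divisor (Coprime.coprime-/gcd a b)
    (*-cancelʳ-∣ g (subst₂ _∣_ (sym a≡)
      (trans (cong (u *_) (sym b≡)) (trans (sym (*-assoc u b′ g)) (cong (_* g) (*-comm u b′))))
      (proj₂ (proj₂ loc))))

C-factorials : ∀ i j → ((i + j) C i) * (i ! * j !) ≡ (i + j) !
C-factorials i j = trans (cong (_* (i ! * j !))
    (trans (nCk≡n!/k![n-k]! (m≤m+n i j)) (/-congʳ {o = i ! * j !} (cong (λ x → i ! * x !) (m+n∸m≡n i j)))))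
  (m/n*n≡m (subst (λ x → i ! * x ! ∣ (i + j) !) (m+n∸m≡n i j) (k![n∸k]!∣n! (m≤m+n i j))))
  where instance
    _ = i !* j !≢0
    _ = i !* (i + j ∸ i) !≢0

-- The exponent l(n, p) and the p-part of d

foldr-⊔-closed : ∀ {ℓ} (P : Pred ℕ ℓ) → P 0 → ∀ {xs} → All P xs → P (foldr _⊔_ 0 xs)
foldr-⊔-closed P P0 [] = P0
foldr-⊔-closed P P0 {x ∷ xs} (Px ∷ Pxs) with ⊔-sel x (foldr _⊔_ 0 xs)
... | inj₁ eq = subst P (sym eq) Px
... | inj₂ eq = subst P (sym eq) (foldr-⊔-closed P P0 Pxs)

∈⇒≤foldr-⊔ : ∀ {x xs} → x ∈ xs → x ≤ foldr _⊔_ 0 xs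
∈⇒≤foldr-⊔ (here refl) = m≤m⊔n _ _
∈⇒≤foldr-⊔ (there x∈) = ≤-trans (∈⇒≤foldr-⊔ x∈) (m≤n⊔m _ _)

n<2+q^n : ∀ q n → n < (2 + q) ^ n
n<2+q^n q zero = s≤s z≤n
n<2+q^n q (suc n) = ≤-trans (s≤s (n<2+q^n q n))
  (≤-trans (+-monoˡ-≤ ((2 + q) ^ n) (m^n>0 (2 + q) n)) (+-monoʳ-≤ ((2 + q) ^ n) (m≤m+n _ _)))

prime∣prime^⇒≡ : ∀ {p r} e → Prime p → Prime r → p ∣ r ^ e → p ≡ r
prime∣prime^⇒≡ zero pr _ d with ∣1⇒≡1 d
... | refl = contradiction pr ¬prime[1]
prime∣prime^⇒≡ {r = r} (suc e) pr prr d with euclidsLemma r (r ^ e) pr d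
... | inj₂ d′ = prime∣prime^⇒≡ e pr prr d′
... | inj₁ d′ with prime⇒irreducible prr d′
... | inj₁ refl = contradiction pr ¬prime[1]
... | inj₂ eq = eq

module _ (n p-1 : ℕ) where

  private
    P = suc p-1

  ∤-product : ∀ {ps} → Prime P → All Prime ps → P ∉ ps → ¬ (P ∣ foldr _*_ 1 (map (primePowFactor n) ps))
  ∤-product pr [] _ d with ∣1⇒≡1 d
  ... | refl = ¬prime[1] pr
  ∤-product pr (_∷_ {zero} pr0 _) _ d = ¬prime[0] pr0
  ∤-product pr (_∷_ {suc r} prr prs) P∉ d with euclidsLemma (suc r ^ l n (suc r)) _ pr d
  ... | inj₂ d′ = ∤-product pr prs (P∉ ∘ there) d′
  ... | inj₁ d′ = P∉ (here (prime∣prime^⇒≡ (l n (suc r)) pr prr d′))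

  -- The primes in the list are distinct, so P divides only the factor that belongs to P itself.
  product-split : ∀ {ps} → Prime P → All Prime ps → Unique ps → P ∈ ps →
    ∃ λ m → foldr _*_ 1 (map (primePowFactor n) ps) ≡ P ^ l n P * m × ¬ (P ∣ m)
  product-split pr (_ ∷ prs) (P≢ ∷ _) (here refl) = _ , refl , ∤-product pr prs λ P∈ → All.lookup P≢ P∈ refl
  product-split pr (_∷_ {zero} pr0 _) _ (there _) = contradiction pr0 ¬prime[0]
  product-split pr (_∷_ {suc r} {ps} prr prs) (r≢ ∷ uniq) (there P∈) with product-split pr prs uniq P∈
  ... | m , eq , P∤m = suc r ^ l n (suc r) * m
      , trans (cong (suc r ^ l n (suc r) *_) eq)
          (solve 3 (λ a b c → a :* (b :* c) := b :* (a :* c)) refl (suc r ^ l n (suc r)) (P ^ l n P) m)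
      , λ d → [ (λ d′ → All.lookup r≢ P∈ (sym (prime∣prime^⇒≡ (l n (suc r)) pr prr d′))) , P∤m ]′
                (euclidsLemma (suc r ^ l n (suc r)) m pr d)
    where open +-*-Solver

module BCHValuation (q : ℕ) (pr : Prime (2 + q)) where
  open PrimeValuation q pr public

  module _ {n : ℕ} (0<n : 0 < n) where

    private
      P? : Decidable (λ t → p ^ t ≤ s p n)
      P? t = p ^ t ≤? s p n

    p^l≤s : p ^ l n p ≤ s p n
    p^l≤s = foldr-⊔-closed (λ t → p ^ t ≤ s p n) (s-pos n 0<n) (All.all-filter P? (upTo (suc (s p n))))

    s<p^1+l : s p n < p ^ suc (l n p)
    s<p^1+l with s p n <? p ^ suc (l n p)
    ... | yes lt = lt
    ... | no ≮ = contradiction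
      (∈⇒≤foldr-⊔ (∈-filter⁺ P? {suc (l n p)} (∈-upTo⁺ (s≤s (≤-trans (<⇒≤ (n<2+q^n q (suc (l n p)))) (≮⇒≥ ≮))))
          (≮⇒≥ ≮)))
      1+n≰n

    s<p⇒l≡0 : s p n < p → l n p ≡ 0
    s<p⇒l≡0 s<p = aux (l n p) refl
      where
      aux : ∀ t → l n p ≡ t → l n p ≡ 0
      aux zero eq = eq
      aux (suc t) eq = contradiction (≤-<-trans (≤-trans
          (≤-trans (m≤m*n p (p ^ t) {{m^n≢0 p t}}) (≤-reflexive (cong (p ^_) (sym eq)))) p^l≤s) s<p) 1+n≰n

    -- The product in `d` stops below n. For p ≥ n the digit sum is less than p, so l n p = 0 and
    -- the formula remains true.
    d-split : ∃ λ m → d n ≡ p ^ l n p * m × ¬ (p ∣ m)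
    d-split with p <? n
    ... | yes p<n = product-split n (suc q) pr (All.all-filter prime? (upTo n))
        (Unique.filter⁺ prime? (Unique.upTo⁺ n))
                      (∈-filter⁺ prime? (∈-upTo⁺ p<n) pr)
    ... | no p≮n = d n , trans (sym (*-identityˡ (d n))) (cong (λ t → p ^ t * d n) (sym (s<p⇒l≡0 s<p)))
                 , ∤-product n (suc q) pr (All.all-filter prime? (upTo n))
                     (λ p∈ → p≮n (∈-upTo⁻ (proj₁ (∈-filter⁻ prime? {xs = upTo n} p∈))))
      where
      s<p : s p n < p
      s<p with m≤n⇒m<n∨m≡n (≮⇒≥ p≮n)
      ... | inj₁ n<p = subst (_< p) (sym (s-small n n<p)) n<p
      ... | inj₂ refl = subst (λ x → s p x < p) (*-identityʳ p) (subst (_< p) (sym (s-pow 1)) (s≤s (s≤s z≤n)))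

  -- Kummer's theorem: Legendre's formula at i, j and i + j identifies e with the number of carries
  -- in the addition, each of which costs p - 1 in the digit sum.
  C-valuation : ∀ i j → ∃ λ e → p ^ e ∣ ((i + j) C i) × s p i + s p j ≡ s p (i + j) + suc q * e
  C-valuation i j with legendre i | legendre j | legendre (i + j)
  ... | a , u , p∤u , eq₁ , eq₁′ | b , u′ , p∤u′ , eq₂ , eq₂′ | v , w , p∤w , eq₃ , eq₃′ =
      v ∸ (a + b)
    , pow∣-coprime (v ∸ (a + b)) (∤-* p∤u p∤u′) (subst (p ^ (v ∸ (a + b)) ∣_) (*-comm c (u * u′))
        (*-cancelˡ-∣ (p ^ (a + b)) {{m^n≢0 p (a + b)}} (subst₂ _∣_ powers eqC (m∣m*n w))))
    , +-cancelʳ-≡ (suc q * (a + b)) _ _ (begin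
        s p i + s p j + suc q * (a + b)                      ≡⟨ solve 5
            (λ x y q a b → x :+ y :+ q :* (a :+ b) := x :+ q :* a :+ (y :+ q :* b)) refl (s p i) (s p j)
            (suc q) a b ⟩
        (s p i + suc q * a) + (s p j + suc q * b)            ≡⟨ sym (cong₂ _+_ eq₁′ eq₂′) ⟩
        i + j                                                ≡⟨ eq₃′ ⟩
        s p (i + j) + suc q * v                              ≡⟨ cong (λ x → s p (i + j) + suc q * x)
            (sym (m∸n+n≡m a+b≤v)) ⟩
        s p (i + j) + suc q * (v ∸ (a + b) + (a + b))        ≡⟨ solve 4
            (λ x q e f → x :+ q :* (e :+ f) := x :+ q :* e :+ q :* f) refl (s p (i + j)) (suc q) (v ∸ (a + b))
            (a + b) ⟩
        s p (i + j) + suc q * (v ∸ (a + b)) + suc q * (a + b) ∎)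
    where
    open ≡-Reasoning
    open +-*-Solver
    c = (i + j) C i
    eqC : p ^ v * w ≡ p ^ (a + b) * (c * (u * u′))
    eqC = trans (sym eq₃) (trans (sym (C-factorials i j)) (trans (cong (c *_) (cong₂ _*_ eq₁ eq₂))
      (trans (solve 5 (λ c x u y u′ → c :* (x :* u :* (y :* u′)) := x :* y :* (c :* (u :* u′))) refl c (p ^ a) u
          (p ^ b) u′)
        (cong (_* (c * (u * u′))) (sym (^-distribˡ-+-* p a b))))))
    a+b≤v : a + b ≤ v
    a+b≤v = pow∣⇒≤ (a + b) v p∤w (subst (p ^ (a + b) ∣_) (sym eqC) (m∣m*n _))
    powers : p ^ v ≡ p ^ (a + b) * p ^ (v ∸ (a + b))
    powers = trans (cong (p ^_) (sym (m+[n∸m]≡n a+b≤v))) (^-distribˡ-+-* p (a + b) (v ∸ (a + b)))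

-- Integers inside the rationals

abstract
  fromℤ : ℤ → ℚ
  fromℤ z = mkℚ z 0 (Coprime.sym (Coprime.1-coprimeTo ℤ.∣ z ∣))

  fromℤ-0 : fromℤ (+ 0) ≡ 0ℚ
  fromℤ-0 = refl

  fromℤ-1 : fromℤ (+ 1) ≡ 1ℚ
  fromℤ-1 = refl

  fromℤ-+ : ∀ a b → fromℤ (a ℤ.+ b) ≡ fromℤ a ℚ.+ fromℤ b
  fromℤ-+ a b = ℚ.toℚᵘ-injective (ℚᵘ.≃-sym (ℚᵘ.≃-trans (ℚ.toℚᵘ-homo-+ (fromℤ a) (fromℤ b))
    (*≡* (cong (ℤ._* + 1) (cong₂ ℤ._+_ (ℤ.*-identityʳ a) (ℤ.*-identityʳ b))))))

  fromℤ-* : ∀ a b → fromℤ (a ℤ.* b) ≡ fromℤ a ℚ.* fromℤ b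
  fromℤ-* a b = ℚ.toℚᵘ-injective (ℚᵘ.≃-sym (ℚᵘ.≃-trans (ℚ.toℚᵘ-homo-* (fromℤ a) (fromℤ b)) (*≡* refl)))

  fromℤ-neg : ∀ a → fromℤ (ℤ.- a) ≡ ℚ.- fromℤ a
  fromℤ-neg a = ℚ.toℚᵘ-injective (ℚᵘ.≃-sym (ℚᵘ.≃-trans (ℚ.toℚᵘ-homo‿- (fromℤ a)) (*≡* refl)))

  fromℤ-injective : ∀ {a b} → fromℤ a ≡ fromℤ b → a ≡ b
  fromℤ-injective = cong ℚ.↥_

  fromℤ-*-1/ : ∀ k .{{_ : NonZero k}} → fromℤ (+ k) ℚ.* (+ 1 ℚ./ k) ≡ 1ℚ
  fromℤ-*-1/ (suc k) = ℚ.toℚᵘ-injective (ℚᵘ.≃-trans (ℚ.toℚᵘ-homo-* (fromℤ (+ suc k)) (+ 1 ℚ./ suc k))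
    (ℚᵘ.≃-trans (ℚᵘ.*-congˡ {mkℚᵘ (+ suc k) 0} (ℚ.toℚᵘ-fromℚᵘ (mkℚᵘ (+ 1) k)))
      (*≡* (solve 1 (λ x → x :* con (+ 1) :* con (+ 1) := con (+ 1) :* (con (+ 1) :* x)) refl (+ suc k)))))
    where open ℤSolver.+-*-Solver

  clear-denominator : ∀ (r : ℚ) (a : ℤ) u → fromℤ (+ u) ℚ.* r ≡ fromℤ a → + u ℤ.* ℚ.↥ r ≡ a ℤ.* ℚ.↧ r
  clear-denominator r@(mkℚ ν δ-1 _) a u eq =
    trans (solve 2 (λ x y → x :* y := x :* y :* con (+ 1)) refl (+ u) ν)
      (trans (ℚᵘ.drop-*≡* (ℚᵘ.≃-trans (ℚᵘ.≃-sym (ℚ.toℚᵘ-homo-* (fromℤ (+ u)) r)) (ℚᵘ.≃-reflexive (cong toℚᵘ eq))))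
        (cong (λ x → a ℤ.* + suc x) (+-identityʳ δ-1)))
    where open ℤSolver.+-*-Solver

fromℕ : ℕ → ℚ
fromℕ n = fromℤ (+ n)

fromℕ-injective : ∀ {a b} → fromℕ a ≡ fromℕ b → a ≡ b
fromℕ-injective eq = ℤ.+-injective (fromℤ-injective eq)

fromℕ-+ : ∀ a b → fromℕ (a + b) ≡ fromℕ a ℚ.+ fromℕ b
fromℕ-+ a b = fromℤ-+ (+ a) (+ b)

fromℕ-* : ∀ a b → fromℕ (a * b) ≡ fromℕ a ℚ.* fromℕ b
fromℕ-* a b = trans (cong fromℤ (ℤ.pos-* a b)) (fromℤ-* (+ a) (+ b))

-- Convolution and the coefficients of X

sumℚ-closed : ∀ {X : Set} (P : ℚ → Set) → P 0ℚ → (∀ {a b} → P a → P b → P (a ℚ.+ b)) →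
  (h : X → ℚ) → ∀ {xs} → All (P ∘ h) xs → P (sumℚ (map h xs))
sumℚ-closed P P0 P+ h [] = P0
sumℚ-closed P P0 P+ h (Px ∷ Pxs) = P+ Px (sumℚ-closed P P0 P+ h Pxs)

splits-++ : ∀ w → All (λ uv → proj₁ uv ++ proj₂ uv ≡ w) (splits w)
splits-++ []      = refl ∷ []
splits-++ (x ∷ w) = refl ∷ All.map⁺ (All.map (cong (x ∷_)) (splits-++ w))

⊛-closed : ∀ (P : ℚ → Set) → P 0ℚ → (∀ {a b} → P a → P b → P (a ℚ.+ b)) →
  ∀ f g w → (∀ u v → u ++ v ≡ w → P (f u ℚ.* g v)) → P ((f ⊛ g) w)
⊛-closed P P0 P+ f g w Pfg = sumℚ-closed P P0 P+ _ (All.map (λ {uv} → Pfg (proj₁ uv) (proj₂ uv)) (splits-++ w))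

sumSplits : (Word → Word → ℕ) → Word → ℕ
sumSplits t w = sum (map (λ uv → t (proj₁ uv) (proj₂ uv)) (splits w))

sumSplits-∷ : ∀ t x w → sumSplits t (x ∷ w) ≡ t [] (x ∷ w) + sumSplits (λ u → t (x ∷ u)) w
sumSplits-∷ t x w = cong (λ z → t [] (x ∷ w) + sum z) (sym (map-∘ (splits w)))

⊛-sumSplits : ∀ K f g t w → (∀ u v → u ++ v ≡ w → fromℕ K ℚ.* (f u ℚ.* g v) ≡ fromℕ (t u v)) →
  fromℕ K ℚ.* (f ⊛ g) w ≡ fromℕ (sumSplits t w)
⊛-sumSplits K f g t w eqs = go (splits w) (splits-++ w)
  where
  go : ∀ xs → All (λ uv → proj₁ uv ++ proj₂ uv ≡ w) xs →
    fromℕ K ℚ.* sumℚ (map (λ uv → f (proj₁ uv) ℚ.* g (proj₂ uv)) xs) ≡ fromℕ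
        (sum (map (λ uv → t (proj₁ uv) (proj₂ uv)) xs))
  go [] [] = trans (ℚ.*-zeroʳ (fromℕ K)) (sym fromℤ-0)
  go ((u , v) ∷ xs) (eq ∷ eqs′) = trans (ℚ.*-distribˡ-+ (fromℕ K) (f u ℚ.* g v) _)
    (trans (cong₂ ℚ._+_ (eqs u v eq) (go xs eqs′)) (sym (fromℕ-+ (t u v) _)))

1/[_!*_!] : ℕ → ℕ → ℚ
1/[ i !* j !] = (+ 1 ℚ./ (i ! * j !)) {{i !* j !≢0}}

-- The metas are solved by the local function of coeffBs, which has no name outside Defs.
mutual
  run : ℕ → Word → ℕ → Word → ℚ
  run = _

  run-coeffBs : ∀ i w u j → B ∷ w ≡ u → 2 ≡ j → coeffBs i (B ∷ B ∷ w) ≡ run i u j w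
  run-coeffBs i w u j e₁ e₂ rewrite e₁ | e₂ = refl

-- Natural numbers 0 and 1 instead of propositions, so that the support of X can enter products;
-- `indicator` excludes the empty word.
isBs isABs indicator : Word → ℕ
isBs []      = 1
isBs (A ∷ w) = 0
isBs (B ∷ w) = isBs w
isABs []      = 1
isABs (A ∷ w) = isABs w
isABs (B ∷ w) = isBs w
indicator []      = 0
indicator (x ∷ w) = isABs (x ∷ w)

run-view : ∀ i u j w →
  (∃ λ b → w ≡ replicate b B × run i u j w ≡ 1/[ i !* j + b !] × isBs w ≡ 1) ⊎ (run i u j w ≡ 0ℚ × isBs w ≡ 0)
run-view i u j []      = inj₁ (0 , refl , cong 1/[ i !*_!] (sym (+-identityʳ j)) , refl)
run-view i u j (A ∷ w) = inj₂ (refl , refl)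
run-view i u j (B ∷ w) with run-view i u (suc j) w
... | inj₂ zeros = inj₂ zeros
... | inj₁ (b , refl , eq , one) = inj₁ (suc b , refl , trans eq (cong 1/[ i !*_!] (sym (+-suc j b))) , one)

-- The hypothesis excludes i = 0 with the empty word, where `coeffAs` is 0 but `isABs` is 1: there
-- the constant term of e^A e^B has been subtracted.
coeffAs-view : ∀ i w → 0 < i + length w →
  (∃₂ λ a b → w ≡ replicate a A ++ replicate b B × coeffAs i w ≡ 1/[ i + a !* b !] × isABs w ≡ 1)
  ⊎ (coeffAs i w ≡ 0ℚ × isABs w ≡ 0)
coeffAs-view (suc i) [] _ = inj₁ (0 , 0 , refl , cong 1/[_!* 0 !] (sym (+-identityʳ (suc i))) , refl)
coeffAs-view i (A ∷ w) _ with coeffAs-view (suc i) w (s≤s z≤n)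
... | inj₂ zeros = inj₂ zeros
... | inj₁ (a , b , refl , eq , one) = inj₁ (suc a , b , refl , trans eq (cong 1/[_!* b !] (sym (+-suc i a))) , one)
coeffAs-view i (B ∷ w) _ with run-view i w 1 w
... | inj₂ zeros = inj₂ zeros
... | inj₁ (b , refl , eq , one) = inj₁ (0 , suc b , refl , trans eq
    (cong 1/[_!* suc b !] (sym (+-identityʳ i))) , one)

X-view : ∀ w → (∃₂ λ a b → w ≡ replicate a A ++ replicate b B × X w ≡ 1/[ a !* b !] × indicator w ≡ 1
    × 0 < length w)
  ⊎ (X w ≡ 0ℚ × indicator w ≡ 0)
X-view []      = inj₂ (refl , refl)
X-view (x ∷ w) with coeffAs-view 0 (x ∷ w) (s≤s z≤n)
... | inj₂ (eq , zeros) = inj₂ (eq , zeros)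
... | inj₁ (a , b , eq , eq′ , one) = inj₁ (a , b , eq , eq′ , one , s≤s z≤n)

fromℕ-*0 : ∀ k → fromℕ k ℚ.* 0ℚ ≡ fromℕ 0
fromℕ-*0 k = trans (ℚ.*-zeroʳ (fromℕ k)) (sym fromℤ-0)

fromℕ-*-1/[!*!] : ∀ a b → fromℕ (a ! * b !) ℚ.* 1/[ a !* b !] ≡ 1ℚ
fromℕ-*-1/[!*!] a b = fromℤ-*-1/ (a ! * b !)
  where instance _ = a !* b !≢0

length-AB : ∀ a b → length (replicate a A ++ replicate b B) ≡ a + b
length-AB a b = trans (length-++ (replicate a A)) (cong₂ _+_ (length-replicate a) (length-replicate b))

-- For u = A^a B^b the integer is the binomial coefficient (a + b choose a). The last component
-- records that X has no constant term: a factor that contributes uses up at least one letter.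
length!*X : ∀ u → ∃ λ c → fromℕ (length u !) ℚ.* X u ≡ fromℕ c × (c ≢ 0 → 0 < length u)
length!*X u with X-view u
... | inj₂ (eq , _) = 0 , trans (cong (fromℕ (length u !) ℚ.*_) eq) (fromℕ-*0 (length u !)) , λ c≢0
    → contradiction refl c≢0
... | inj₁ (a , b , refl , eq , _ , pos) = ((a + b) C a) , value , λ _ → pos
  where
  open ≡-Reasoning
  value : fromℕ (length u !) ℚ.* X u ≡ fromℕ ((a + b) C a)
  value = begin
    fromℕ (length u !) ℚ.* X u                                       ≡⟨ cong₂ (λ m x → fromℕ (m !) ℚ.* x)
        (length-AB a b) eq ⟩
    fromℕ ((a + b) !) ℚ.* 1/[ a !* b !]                              ≡⟨ cong (ℚ._* 1/[ a !* b !])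
        (cong fromℕ (sym (C-factorials a b))) ⟩
    fromℕ (((a + b) C a) * (a ! * b !)) ℚ.* 1/[ a !* b !]            ≡⟨ cong (ℚ._* 1/[ a !* b !])
        (fromℕ-* ((a + b) C a) (a ! * b !)) ⟩
    fromℕ ((a + b) C a) ℚ.* fromℕ (a ! * b !) ℚ.* 1/[ a !* b !]      ≡⟨ ℚ.*-assoc (fromℕ ((a + b) C a))
        (fromℕ (a ! * b !)) 1/[ a !* b !] ⟩
    fromℕ ((a + b) C a) ℚ.* (fromℕ (a ! * b !) ℚ.* 1/[ a !* b !])    ≡⟨ cong (fromℕ ((a + b) C a) ℚ.*_)
        (fromℕ-*-1/[!*!] a b) ⟩
    fromℕ ((a + b) C a) ℚ.* 1ℚ                                       ≡⟨ ℚ.*-identityʳ (fromℕ ((a + b) C a)) ⟩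
    fromℕ ((a + b) C a)                                              ∎

-- Terms of the logarithm

σ : ℕ → ℤ
σ zero    = -[1+ 0 ]
σ (suc k) = ℤ.- σ k

sign≡ : ∀ k → sign k ≡ fromℤ (σ k)
sign≡ zero    = sym (trans (fromℤ-neg (+ 1)) (cong ℚ.-_ fromℤ-1))
sign≡ (suc k) = trans (cong ℚ.-_ (sign≡ k)) (sym (fromℤ-neg (σ k)))

∣σ∣≡1 : ∀ k → ℤ.∣ σ k ∣ ≡ 1
∣σ∣≡1 zero    = refl
∣σ∣≡1 (suc k) = trans (ℤ.∣-i∣≡∣i∣ (σ k)) (∣σ∣≡1 k)

-- N clears the coefficient of X ^ k, and Q, later `d n`, has to absorb the denominator k, up to the
-- auxiliary factor u.
logCoeff-term : ∀ N Q k .{{_ : NonZero k}} x G u g → fromℕ N ℚ.* x ≡ fromℕ G → u * (Q * G) ≡ k * g →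
  fromℕ u ℚ.* (fromℕ (N * Q) ℚ.* (logCoeff k ℚ.* x)) ≡ fromℤ (σ k ℤ.* + g)
logCoeff-term N Q k x G u g eqG eqg = begin
  fromℕ u ℚ.* (fromℕ (N * Q) ℚ.* (sign k ℚ.* r ℚ.* x))
    ≡⟨ cong (λ y → fromℕ u ℚ.* (y ℚ.* (sign k ℚ.* r ℚ.* x))) (fromℕ-* N Q) ⟩
  fromℕ u ℚ.* (fromℕ N ℚ.* fromℕ Q ℚ.* (sign k ℚ.* r ℚ.* x))
    ≡⟨ solve 6 (λ u N Q s r x → u :* (N :* Q :* (s :* r :* x)) := s :* (u :* (Q :* (N :* x)) :* r)) refl
        (fromℕ u) (fromℕ N) (fromℕ Q) (sign k) r x ⟩
  sign k ℚ.* (fromℕ u ℚ.* (fromℕ Q ℚ.* (fromℕ N ℚ.* x)) ℚ.* r)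
    ≡⟨ cong (λ y → sign k ℚ.* (fromℕ u ℚ.* (fromℕ Q ℚ.* y) ℚ.* r)) eqG ⟩
  sign k ℚ.* (fromℕ u ℚ.* (fromℕ Q ℚ.* fromℕ G) ℚ.* r)
    ≡⟨ cong (λ y → sign k ℚ.* (y ℚ.* r)) (sym (trans (fromℕ-* u (Q * G)) (cong (fromℕ u ℚ.*_) (fromℕ-* Q G)))) ⟩
  sign k ℚ.* (fromℕ (u * (Q * G)) ℚ.* r)
    ≡⟨ cong (λ y → sign k ℚ.* (y ℚ.* r)) (trans (cong fromℕ eqg) (fromℕ-* k g)) ⟩
  sign k ℚ.* (fromℕ k ℚ.* fromℕ g ℚ.* r)
    ≡⟨ solve 4 (λ s k g r → s :* (k :* g :* r) := s :* g :* (k :* r)) refl (sign k) (fromℕ k) (fromℕ g) r ⟩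
  sign k ℚ.* fromℕ g ℚ.* (fromℕ k ℚ.* r)
    ≡⟨ trans (cong (sign k ℚ.* fromℕ g ℚ.*_) (fromℤ-*-1/ k)) (ℚ.*-identityʳ _) ⟩
  sign k ℚ.* fromℕ g
    ≡⟨ trans (cong (ℚ._* fromℕ g) (sign≡ k)) (sym (fromℤ-* (σ k) (+ g))) ⟩
  fromℤ (σ k ℤ.* + g) ∎
  where
  open ≡-Reasoning
  open ℚSolver
  r = + 1 ℚ./ k

-- Divisibility of the coefficients of X ^ k

module Local (q : ℕ) (pr : Prime (2 + q)) where
  open BCHValuation q pr public

  -- Induction on the number of factors. Splitting off a piece of length i brings in (i + j choose
  -- i), with one factor p for each carry. A carry costs p - 1 in the digit sum, and the piece
  -- itself takes at least 1 of it. Adding p - 1 on the right avoids a truncated e - 1 at e = 0.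
  X^-divisibility : ∀ k w → ∃ λ g → fromℕ (length w !) ℚ.* (X ^S k) w ≡ fromℕ g
    × (∀ e → s p (length w) + suc q * e < k + suc q → p ^ e ∣ g)
  X^-divisibility zero []      = 1 , trans (ℚ.*-identityʳ (fromℕ 1)) refl , λ { zero _ → ∣-refl
    ; (suc e) lt → contradiction (≤-trans lt (m≤m*n (suc q) (suc e))) 1+n≰n }
  X^-divisibility zero (x ∷ w) = 0 , fromℕ-*0 (length (x ∷ w) !) , λ e _ → (p ^ e) ∣0
  X^-divisibility (suc k) w = ⊛-closed P P0 P+ X (X ^S k) w Psplit
    where
    n = length w
    P : ℚ → Set
    P r = ∃ λ g → fromℕ (n !) ℚ.* r ≡ fromℕ g × (∀ e → s p n + suc q * e < suc k + suc q → p ^ e ∣ g)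
    P0 : P 0ℚ
    P0 = 0 , fromℕ-*0 (n !) , λ e _ → (p ^ e) ∣0
    P+ : ∀ {a b} → P a → P b → P (a ℚ.+ b)
    P+ {a} {b} (g , eq , div) (g′ , eq′ , div′) = g + g′
      , trans (ℚ.*-distribˡ-+ (fromℕ (n !)) a b) (trans (cong₂ ℚ._+_ eq eq′) (sym (fromℕ-+ g g′)))
      , λ e lt → ∣m∣n⇒∣m+n (div e lt) (div′ e lt)
    Psplit : ∀ u v → u ++ v ≡ w → P (X u ℚ.* (X ^S k) v)
    Psplit u v refl with length!*X u | X^-divisibility k v
    ... | c , eqc , pos | g , eqg , div = ((i + j) C i) * (c * g) , value , divides′
      where
      open ≡-Reasoning
      i = length u
      j = length v
      b = (i + j) C i
      value : fromℕ (n !) ℚ.* (X u ℚ.* (X ^S k) v) ≡ fromℕ (b * (c * g))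
      value = begin
        fromℕ (n !) ℚ.* (X u ℚ.* (X ^S k) v)
          ≡⟨ cong (λ m → fromℕ m ℚ.* (X u ℚ.* (X ^S k) v))
              (trans (cong _! (length-++ u)) (sym (C-factorials i j))) ⟩
        fromℕ (b * (i ! * j !)) ℚ.* (X u ℚ.* (X ^S k) v)
          ≡⟨ cong (ℚ._* (X u ℚ.* (X ^S k) v)) (trans (fromℕ-* b (i ! * j !))
              (cong (fromℕ b ℚ.*_) (fromℕ-* (i !) (j !)))) ⟩
        fromℕ b ℚ.* (fromℕ (i !) ℚ.* fromℕ (j !)) ℚ.* (X u ℚ.* (X ^S k) v)
          ≡⟨ solve 5 (λ b i j x y → b :* (i :* j) :* (x :* y) := b :* ((i :* x) :* (j :* y))) refl (fromℕ b)
              (fromℕ (i !)) (fromℕ (j !)) (X u) ((X ^S k) v) ⟩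
        fromℕ b ℚ.* ((fromℕ (i !) ℚ.* X u) ℚ.* (fromℕ (j !) ℚ.* (X ^S k) v))
          ≡⟨ cong (fromℕ b ℚ.*_) (cong₂ ℚ._*_ eqc eqg) ⟩
        fromℕ b ℚ.* (fromℕ c ℚ.* fromℕ g)
          ≡⟨ sym (trans (fromℕ-* b (c * g)) (cong (fromℕ b ℚ.*_) (fromℕ-* c g))) ⟩
        fromℕ (b * (c * g)) ∎
        where open ℚSolver
      divides′ : ∀ e → s p n + suc q * e < suc k + suc q → p ^ e ∣ b * (c * g)
      divides′ e lt with c ≟ 0
      ... | yes refl = subst (p ^ e ∣_) (sym (*-zeroʳ b)) ((p ^ e) ∣0)
      ... | no c≢0 = carry (C-valuation i j)
        where
        carry : (∃ λ e₁ → p ^ e₁ ∣ b × s p i + s p j ≡ s p (i + j) + suc q * e₁) → p ^ e ∣ b * (c * g)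
        carry (e₁ , div₁ , carries) with e ≤? e₁
        ... | yes e≤e₁ = ∣-trans (m≤n⇒m^n∣m^o e≤e₁) (∣-trans div₁ (m∣m*n (c * g)))
          where
          m≤n⇒m^n∣m^o : ∀ {x y} → x ≤ y → p ^ x ∣ p ^ y
          m≤n⇒m^n∣m^o {x} {y} x≤y = subst (p ^ x ∣_)
              (trans (sym (^-distribˡ-+-* p x (y ∸ x))) (cong (p ^_) (m+[n∸m]≡n x≤y))) (m∣m*n (p ^ (y ∸ x)))
        ... | no e≰e₁ = subst (_∣ b * (c * g)) (trans (sym (^-distribˡ-+-* p e₁ e₂)) (cong (p ^_) e₁+e₂≡e))
              (*-pres-∣ div₁ (∣-trans (div e₂ lt₂) (n∣m*n c)))
          where
          e₂ = e ∸ e₁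
          e₁+e₂≡e : e₁ + e₂ ≡ e
          e₁+e₂≡e = m+[n∸m]≡n (<⇒≤ (≰⇒> e≰e₁))
          rearranged : s p n + suc q * e ≡ s p i + (s p j + suc q * e₂)
          rearranged = trans (cong₂ (λ x y → s p x + suc q * y) (length-++ u) (sym e₁+e₂≡e))
            (trans (solve 4 (λ x q a b → x :+ q :* (a :+ b) := x :+ q :* a :+ q :* b) refl (s p (i + j))
                (suc q) e₁ e₂)
              (trans (cong (_+ suc q * e₂) (sym carries)) (+-assoc (s p i) (s p j) (suc q * e₂))))
            where open +-*-Solver
          -- The nonempty piece u has digit sum at least 1, which pays for the step from suc k to k.
          lt₂ : s p j + suc q * e₂ < k + suc q
          lt₂ = ≤-pred (≤-trans (s≤s (+-monoˡ-≤ (s p j + suc q * e₂) (s-pos i (pos c≢0))))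
              (subst (_< suc k + suc q) rearranged lt))

-- The common denominator

sumℚ-upTo-closed : ∀ (P : ℚ → Set) → P 0ℚ → (∀ {a b} → P a → P b → P (a ℚ.+ b)) →
  ∀ (h : ℕ → ℚ) n → (∀ i → i < n → P (h i)) → P (sumℚ (map h (upTo n)))
sumℚ-upTo-closed P P0 P+ h n Ph = sumℚ-closed P P0 P+ h (All.map (λ {i} → Ph i) (All.all-upTo n))

-- Meant for P = "divisible by p" and Q = "unit at p": a single unit among multiples of p makes the
-- sum a unit.
sumℚ-upTo-isolate : ∀ (P Q : ℚ → Set) → P 0ℚ → (∀ {a b} → P a → P b → P (a ℚ.+ b)) →
  (∀ {a b} → Q a → P b → Q (a ℚ.+ b)) →
  ∀ (h : ℕ → ℚ) n i → i < n → Q (h i) → (∀ j → j < n → j ≢ i → P (h j)) → Q (sumℚ (map h (upTo n)))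
sumℚ-upTo-isolate P Q P0 P+ Q+ h n i = go h id n i
  where
  go : ∀ (h : ℕ → ℚ) (f : ℕ → ℕ) n i → i < n → Q (h (f i)) → (∀ j → j < n → j ≢ i → P (h (f j))) →
       Q (sumℚ (map h (applyUpTo f n)))
  go h f (suc n) zero _ Qh Ph = Q+ Qh (sumℚ-closed P P0 P+ h
    (All.applyUpTo⁺₁ (f ∘ suc) n λ {j} j<n → Ph (suc j) (s≤s j<n) λ ()))
  go h f (suc n) (suc i) (s≤s i<n) Qh Ph = subst Q (ℚ.+-comm _ (h (f zero)))
    (Q+ (go h (f ∘ suc) n i i<n Qh λ j j<n j≢i → Ph (suc j) (s≤s j<n) (j≢i ∘ suc-injective)) (Ph 0 (s≤s z≤n) λ ()))

-- Each multiplication by suc Q adds at least Q. A bound that holds at one power of p thus passes to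
-- all higher powers.
growth : ∀ {s Q P} e → 0 < P → s < P → s + Q * e < P * suc Q ^ e
growth {s} {Q} {P} zero _ s<P = subst₂ _<_ (sym (trans (cong (λ x → s + x) (*-zeroʳ Q)) (+-identityʳ s)))
    (sym (*-identityʳ P)) s<P
growth {s} {Q} {P} (suc e) 0<P s<P = begin-strict
  s + Q * suc e                        ≡⟨ solve 3
      (λ s Q e → s :+ Q :* (con 1 :+ e) := (s :+ Q :* e) :+ Q) refl s Q e ⟩
  (s + Q * e) + Q                      <⟨ +-monoˡ-< Q (growth e 0<P s<P) ⟩
  P * suc Q ^ e + Q                    ≤⟨ +-monoʳ-≤ (P * suc Q ^ e)
      (≤-trans (≤-reflexive (sym (*-identityˡ Q))) (*-monoˡ-≤ Q (*-mono-≤ 0<P (m^n>0 (suc Q) e)))) ⟩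
  P * suc Q ^ e + P * suc Q ^ e * Q    ≡⟨ solve 3
      (λ P x Q → P :* x :+ P :* x :* Q := P :* ((con 1 :+ Q) :* x)) refl P (suc Q ^ e) Q ⟩
  P * suc Q ^ suc e                    ∎
  where
  open ≤-Reasoning
  open +-*-Solver

module LocalSum (q : ℕ) (pr : Prime (2 + q)) where
  open Local q pr public

  -- r ∈ M ℤ₍ₚ₎
  _∣ₚ_ : ℕ → ℚ → Set
  M ∣ₚ r = ∃₂ λ u a → ¬ (p ∣ u) × fromℕ u ℚ.* r ≡ fromℤ (+ M ℤ.* a)

  Unitₚ : ℚ → Set
  Unitₚ r = ∃₂ λ u a → ¬ (p ∣ u) × ¬ (p ∣ ℤ.∣ a ∣) × fromℕ u ℚ.* r ≡ fromℤ a

  cross-+ : ∀ u u′ {r r′ a a′} → fromℕ u ℚ.* r ≡ fromℤ a → fromℕ u′ ℚ.* r′ ≡ fromℤ a′ →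
    fromℕ (u * u′) ℚ.* (r ℚ.+ r′) ≡ fromℤ (+ u′ ℤ.* a ℤ.+ + u ℤ.* a′)
  cross-+ u u′ {r} {r′} {a} {a′} eq eq′ = begin
    fromℕ (u * u′) ℚ.* (r ℚ.+ r′)                                     ≡⟨ cong (ℚ._* (r ℚ.+ r′)) (fromℕ-* u u′) ⟩
    fromℕ u ℚ.* fromℕ u′ ℚ.* (r ℚ.+ r′)                               ≡⟨ solve 4
        (λ u u′ r r′ → u :* u′ :* (r :+ r′) := u′ :* (u :* r) :+ u :* (u′ :* r′)) refl (fromℕ u) (fromℕ u′) r r′ ⟩
    fromℕ u′ ℚ.* (fromℕ u ℚ.* r) ℚ.+ fromℕ u ℚ.* (fromℕ u′ ℚ.* r′)    ≡⟨ cong₂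
        (λ x y → fromℕ u′ ℚ.* x ℚ.+ fromℕ u ℚ.* y) eq eq′ ⟩
    fromℕ u′ ℚ.* fromℤ a ℚ.+ fromℕ u ℚ.* fromℤ a′                     ≡⟨ sym
        (trans (fromℤ-+ (+ u′ ℤ.* a) (+ u ℤ.* a′)) (cong₂ ℚ._+_ (fromℤ-* (+ u′) a) (fromℤ-* (+ u) a′))) ⟩
    fromℤ (+ u′ ℤ.* a ℤ.+ + u ℤ.* a′)                                 ∎
    where
    open ≡-Reasoning
    open ℚSolver

  ∣ₚ-0 : ∀ M → M ∣ₚ 0ℚ
  ∣ₚ-0 M = 1 , + 0 , p∤1 , trans (fromℕ-*0 1) (cong fromℤ (sym (ℤ.*-zeroʳ (+ M))))

  ∣ₚ-+ : ∀ M {r r′} → M ∣ₚ r → M ∣ₚ r′ → M ∣ₚ (r ℚ.+ r′)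
  ∣ₚ-+ M (u , a , p∤u , eq) (u′ , a′ , p∤u′ , eq′) = u * u′ , + u′ ℤ.* a ℤ.+ + u ℤ.* a′ , ∤-* p∤u p∤u′
    , trans (cross-+ u u′ eq eq′) (cong fromℤ (solve 5
        (λ M u u′ a a′ → u′ :* (M :* a) :+ u :* (M :* a′) := M :* (u′ :* a :+ u :* a′)) refl (+ M) (+ u)
        (+ u′) a a′))
    where open ℤSolver.+-*-Solver

  Unitₚ-+ : ∀ {r r′} → Unitₚ r → p ∣ₚ r′ → Unitₚ (r ℚ.+ r′)
  Unitₚ-+ (u , a , p∤u , p∤a , eq) (u′ , a′ , p∤u′ , eq′) =
    u * u′ , _ , ∤-* p∤u p∤u′ , p∤sum , cross-+ u u′ eq eq′
    where
    p∤sum : ¬ (p ∣ ℤ.∣ + u′ ℤ.* a ℤ.+ + u ℤ.* (+ p ℤ.* a′) ∣)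
    p∤sum d = ∤-* p∤u′ p∤a (subst (p ∣_) (ℤ.abs-* (+ u′) a)
      (ℤ∣.∣⇒∣ᵤ (ℤ∣.∣m+n∣n⇒∣m {+ p} {+ u′ ℤ.* a} {+ u ℤ.* (+ p ℤ.* a′)} (ℤ∣.∣ᵤ⇒∣ {+ p} d)
          (ℤ∣.∣n⇒∣m*n (+ u) (ℤ∣.∣m⇒∣m*n a′ ℤ∣.∣-refl)))))

  H-term : ℕ → Word → ℚ
  H-term k w = logCoeff (suc k) ℚ.* (X ^S suc k) w

  module _ (N : ℕ) (w : Word) where

    H-∣ₚ : ∀ M → (∀ k → k < length w → M ∣ₚ (fromℕ N ℚ.* H-term k w)) → M ∣ₚ (fromℕ N ℚ.* H w)
    H-∣ₚ M = sumℚ-upTo-closed (λ r → M ∣ₚ (fromℕ N ℚ.* r)) (subst (M ∣ₚ_) (sym (ℚ.*-zeroʳ (fromℕ N))) (∣ₚ-0 M))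
      (λ {a} {b} x y → subst (M ∣ₚ_) (sym (ℚ.*-distribˡ-+ (fromℕ N) a b)) (∣ₚ-+ M x y)) (λ k → H-term k w)
          (length w)

    H-Unitₚ : ∀ i → i < length w → Unitₚ (fromℕ N ℚ.* H-term i w) →
      (∀ k → k < length w → k ≢ i → p ∣ₚ (fromℕ N ℚ.* H-term k w)) → Unitₚ (fromℕ N ℚ.* H w)
    H-Unitₚ i = sumℚ-upTo-isolate (λ r → p ∣ₚ (fromℕ N ℚ.* r)) (λ r → Unitₚ (fromℕ N ℚ.* r))
      (subst (p ∣ₚ_) (sym (ℚ.*-zeroʳ (fromℕ N))) (∣ₚ-0 p))
      (λ {a} {b} x y → subst (p ∣ₚ_) (sym (ℚ.*-distribˡ-+ (fromℕ N) a b)) (∣ₚ-+ p x y))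
      (λ {a} {b} x y → subst Unitₚ (sym (ℚ.*-distribˡ-+ (fromℕ N) a b)) (Unitₚ-+ x y)) (λ k → H-term k w)
          (length w) i

  term-∣ₚ : ∀ M N Q k w {G} u g → ¬ (p ∣ u) → fromℕ N ℚ.* (X ^S suc k) w ≡ fromℕ G → u * (Q * G) ≡ suc k * (M * g) →
    M ∣ₚ (fromℕ (N * Q) ℚ.* H-term k w)
  term-∣ₚ M N Q k w {G} u g p∤u eqG eqg = u , σ (suc k) ℤ.* + g , p∤u
    , trans (logCoeff-term N Q (suc k) ((X ^S suc k) w) G u (M * g) eqG eqg)
        (cong fromℤ (trans (cong (σ (suc k) ℤ.*_) (ℤ.pos-* M g))
            (solve 3 (λ s M g → s :* (M :* g) := M :* (s :* g)) refl (σ (suc k)) (+ M) (+ g))))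
    where open ℤSolver.+-*-Solver

  term-Unitₚ : ∀ N Q k w {G} u g → ¬ (p ∣ u) → ¬ (p ∣ g) → fromℕ N ℚ.* (X ^S suc k) w ≡ fromℕ G → u *
      (Q * G) ≡ suc k * g →
    Unitₚ (fromℕ (N * Q) ℚ.* H-term k w)
  term-Unitₚ N Q k w {G} u g p∤u p∤g eqG eqg = u , σ (suc k) ℤ.* + g , p∤u
    , subst (λ x → ¬ (p ∣ x)) (sym (trans (ℤ.abs-* (σ (suc k)) (+ g))
        (trans (cong (_* g) (∣σ∣≡1 (suc k))) (*-identityˡ g)))) p∤g
    , logCoeff-term N Q (suc k) ((X ^S suc k) w) G u g eqG eqg

  module _ {n : ℕ} (0<n : 0 < n) where

    private
      λₙ = l n p
      m = proj₁ (d-split 0<n)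
      d≡ : d n ≡ p ^ λₙ * m
      d≡ = proj₁ (proj₂ (d-split 0<n))

    -- Balance of exponents: `d n` supplies λₙ, the coefficient supplies e, the logarithm takes t,
    -- and j is left. Since suc k ≥ p ^ t, the bound is only required at p ^ t. The uses are j = 0
    -- for integrality and j = 1 for negligible terms.
    high-term : ∀ w → length w ≡ n → ∀ k t k′ → suc k ≡ p ^ t * k′ → ¬ (p ∣ k′) → ∀ M j e → M ≡ p ^ j
        → t + j ≡ λₙ + e →
      s p n + suc q * e < p ^ t + suc q → M ∣ₚ (fromℕ (n ! * d n) ℚ.* H-term k w)
    high-term w refl k t k′ k≡ p∤k′ M j e M≡ exps bound with X^-divisibility (suc k) w
    ... | G , eqG , div = conclude (div e (≤-trans bound (+-monoˡ-≤ (suc q) p^t≤k)))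
      where
      p^t≤k : p ^ t ≤ suc k
      p^t≤k = ≤-trans (m≤m*n (p ^ t) k′ {{≢-nonZero λ { refl → p∤k′ (p ∣0) }}}) (≤-reflexive (sym k≡))
      conclude : p ^ e ∣ G → M ∣ₚ (fromℕ (n ! * d n) ℚ.* H-term k w)
      conclude (divides g G≡) = term-∣ₚ M (n !) (d n) k w k′ (m * g) p∤k′ eqG (begin
        k′ * (d n * G)                         ≡⟨ cong₂ (λ x y → k′ * (x * y)) d≡ G≡ ⟩
        k′ * (p ^ λₙ * m * (g * p ^ e))        ≡⟨ solve 5
            (λ k x m g y → k :* (x :* m :* (g :* y)) := x :* y :* (k :* (m :* g))) refl k′ (p ^ λₙ) m g (p ^ e) ⟩
        p ^ λₙ * p ^ e * (k′ * (m * g))        ≡⟨ cong (_* (k′ * (m * g)))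
            (trans (sym (^-distribˡ-+-* p λₙ e)) (trans (cong (p ^_) (sym exps)) (^-distribˡ-+-* p t j))) ⟩
        p ^ t * p ^ j * (k′ * (m * g))         ≡⟨ solve 4
            (λ x y k z → x :* y :* (k :* z) := x :* k :* (y :* z)) refl (p ^ t) (p ^ j) k′ (m * g) ⟩
        p ^ t * k′ * (p ^ j * (m * g))         ≡⟨ cong₂ (λ x y → x * (y * (m * g))) (sym k≡) (sym M≡) ⟩
        suc k * (M * (m * g))                  ∎)
        where
        open ≡-Reasoning
        open +-*-Solver

    integral-term : ∀ w → length w ≡ n → ∀ k → 1 ∣ₚ (fromℕ (n ! * d n) ℚ.* H-term k w)
    integral-term w refl k = go (factor (suc k) (s≤s z≤n))
      where
      go : (∃₂ λ t k′ → ¬ (p ∣ k′) × suc k ≡ p ^ t * k′) → 1 ∣ₚ (fromℕ (n ! * d n) ℚ.* H-term k w)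
      go (t , k′ , p∤k′ , k≡) with t ≤? λₙ
      -- The logarithm takes t - λₙ = suc e more factors p than `d n` supplies; `growth` starts from
      -- s_p(n) < p ^ suc λₙ.
      ... | no t≰ = high-term w refl k t k′ k≡ p∤k′ 1 0 (suc e) refl exps bound
        where
        e = t ∸ suc λₙ
        t≡ : suc λₙ + e ≡ t
        t≡ = m+[n∸m]≡n (≰⇒> t≰)
        exps : t + 0 ≡ λₙ + suc e
        exps = trans (+-identityʳ t) (trans (sym t≡) (sym (+-suc λₙ e)))
        bound : s p n + suc q * suc e < p ^ t + suc q
        bound = subst₂ _<_ (solve 3 (λ s q e → s :+ q :* e :+ q := s :+ q :* (con 1 :+ e)) refl (s p n) (suc q) e)
          (cong (_+ suc q) (trans (sym (^-distribˡ-+-* p (suc λₙ) e)) (cong (p ^_) t≡)))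
          (+-monoˡ-< (suc q) (growth {Q = suc q} e (m^n>0 p (suc λₙ)) (s<p^1+l 0<n)))
          where open +-*-Solver
      ... | yes t≤ with X^-divisibility (suc k) w
      ... | G , eqG , _ = term-∣ₚ 1 (n !) (d n) k w k′ (p ^ (λₙ ∸ t) * (m * G)) p∤k′ eqG (begin
        k′ * (d n * G)                                  ≡⟨ cong (λ x → k′ * (x * G))
            (trans d≡ (cong (λ x → p ^ x * m) (sym (m+[n∸m]≡n t≤)))) ⟩
        k′ * (p ^ (t + (λₙ ∸ t)) * m * G)               ≡⟨ cong (λ x → k′ * (x * m * G))
            (^-distribˡ-+-* p t (λₙ ∸ t)) ⟩
        k′ * (p ^ t * p ^ (λₙ ∸ t) * m * G)             ≡⟨ solve 5
            (λ k x y m g → k :* (x :* y :* m :* g) := x :* k :* (con 1 :* (y :* (m :* g)))) refl k′ (p ^ t)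
            (p ^ (λₙ ∸ t)) m G ⟩
        p ^ t * k′ * (1 * (p ^ (λₙ ∸ t) * (m * G)))     ≡⟨ cong (_* (1 * (p ^ (λₙ ∸ t) * (m * G)))) (sym k≡) ⟩
        suc k * (1 * (p ^ (λₙ ∸ t) * (m * G)))          ∎)
        where
        open ≡-Reasoning
        open +-*-Solver

    H-integral : ∀ w → length w ≡ n → 1 ∣ₚ (fromℕ (n ! * d n) ℚ.* H w)
    H-integral w eq = H-∣ₚ (n ! * d n) w 1 λ k _ → integral-term w eq k

-- Runs of equal letters and cuts through them

lead : Letter → Word → ℕ
lead x []      = 0
lead A (A ∷ w) = suc (lead A w)
lead A (B ∷ w) = 0
lead B (B ∷ w) = suc (lead B w)
lead B (A ∷ w) = 0

-- suc (lead x w) counts the letters left in the current run, so every maximal run contributes its factorial.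
runFactorial : Word → ℕ
runFactorial []      = 1
runFactorial (x ∷ w) = suc (lead x w) * runFactorial w

lead-same : ∀ x w → lead x (x ∷ w) ≡ suc (lead x w)
lead-same A w = refl
lead-same B w = refl

lead-replicate : ∀ x i v → lead x (replicate i x ++ v) ≡ i + lead x v
lead-replicate x zero    v = refl
lead-replicate x (suc i) v = trans (lead-same x _) (cong suc (lead-replicate x i v))

runFactorial-replicate! : ∀ x i v → runFactorial (replicate i x ++ v) * lead x v ! ≡
    (i + lead x v) ! * runFactorial v
runFactorial-replicate! x zero    v = *-comm (runFactorial v) (lead x v !)
runFactorial-replicate! x (suc i) v = trans
  (*-assoc (suc (lead x (replicate i x ++ v))) (runFactorial (replicate i x ++ v)) (lead x v !))
  (trans (cong₂ (λ a b → suc a * b) (lead-replicate x i v) (runFactorial-replicate! x i v))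
    (sym (*-assoc (suc (i + lead x v)) ((i + lead x v) !) (runFactorial v))))

-- The i new letters may merge with the run at the head of v; the binomial coefficient is the price
-- of replacing i ! times (lead x v) ! by the factorial of the merged run.
runFactorial-replicate : ∀ x i v → runFactorial (replicate i x ++ v) ≡ ((i + lead x v) C i) * (i ! * runFactorial v)
runFactorial-replicate x i v = *-cancelʳ-≡ _ _ (lead x v !) {{lead x v !≢0}} (trans (runFactorial-replicate! x i v)
  (trans (cong (_* runFactorial v) (sym (C-factorials i (lead x v))))
    (solve 4 (λ c a b r → c :* (a :* b) :* r := c :* (a :* r) :* b) refl ((i + lead x v) C i) (i !) (lead x v !)
        (runFactorial v))))
  where open +-*-Solver

n+0Cn≡1 : ∀ n → (n + 0) C n ≡ 1
n+0Cn≡1 n = trans (cong (_C n) (+-identityʳ n)) (nCn≡1 n)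

runFactorial-run : ∀ x i v → lead x v ≡ 0 → runFactorial (replicate i x ++ v) ≡ i ! * runFactorial v
runFactorial-run x i v eq = trans (runFactorial-replicate x i v)
  (trans (cong (λ a → ((i + a) C i) * (i ! * runFactorial v)) eq)
    (trans (cong (_* (i ! * runFactorial v)) (n+0Cn≡1 i)) (*-identityˡ _)))

runFactorial-pure : ∀ x i → runFactorial (replicate i x) ≡ i !
runFactorial-pure x i = trans (cong runFactorial (sym (++-identityʳ (replicate i x))))
  (trans (runFactorial-run x i [] refl) (*-identityʳ (i !)))

-- The run divided by the cut between u and v contributes a binomial coefficient; u is preceded by i letters x.
cutFrom : Letter → ℕ → Word → Word → ℕ
cutFrom x i [] v = (i + lead x v) C i
cutFrom A i (A ∷ u) v = cutFrom A (suc i) u v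
cutFrom A i (B ∷ u) v = cutFrom B 1 u v
cutFrom B i (B ∷ u) v = cutFrom B (suc i) u v
cutFrom B i (A ∷ u) v = cutFrom A 1 u v

cut : Word → Word → ℕ
cut []      v = 1
cut (x ∷ u) v = cutFrom x 1 u v

replicate-∷ : ∀ (x : Letter) i w → replicate i x ++ x ∷ w ≡ replicate (suc i) x ++ w
replicate-∷ x zero    w = refl
replicate-∷ x (suc i) w = cong (x ∷_) (replicate-∷ x i w)

runFactorial-cutFrom : ∀ x i u v →
  runFactorial (replicate i x ++ (u ++ v)) ≡ cutFrom x i u v * (runFactorial (replicate i x ++ u) * runFactorial v)
runFactorial-cutFrom x i [] v = trans (runFactorial-replicate x i v)
  (cong (λ r → ((i + lead x v) C i) * (r * runFactorial v))
    (sym (trans (cong runFactorial (++-identityʳ (replicate i x))) (runFactorial-pure x i))))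
runFactorial-cutFrom A i (A ∷ u) v = trans (cong runFactorial (replicate-∷ A i (u ++ v)))
  (trans (runFactorial-cutFrom A (suc i) u v) (cong
      (λ r → cutFrom A (suc i) u v * (runFactorial r * runFactorial v)) (sym (replicate-∷ A i u))))
runFactorial-cutFrom B i (B ∷ u) v = trans (cong runFactorial (replicate-∷ B i (u ++ v)))
  (trans (runFactorial-cutFrom B (suc i) u v) (cong
      (λ r → cutFrom B (suc i) u v * (runFactorial r * runFactorial v)) (sym (replicate-∷ B i u))))
runFactorial-cutFrom A i (B ∷ u) v = trans (runFactorial-run A i (B ∷ u ++ v) refl)
  (trans (cong (i ! *_) (runFactorial-cutFrom B 1 u v))
    (trans (solve 4 (λ i c r s → i :* (c :* (r :* s)) := c :* (i :* r :* s)) refl (i !) (cutFrom B 1 u v)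
        (runFactorial (B ∷ u)) (runFactorial v))
      (cong (λ r → cutFrom B 1 u v * (r * runFactorial v)) (sym (runFactorial-run A i (B ∷ u) refl)))))
  where open +-*-Solver
runFactorial-cutFrom B i (A ∷ u) v = trans (runFactorial-run B i (A ∷ u ++ v) refl)
  (trans (cong (i ! *_) (runFactorial-cutFrom A 1 u v))
    (trans (solve 4 (λ i c r s → i :* (c :* (r :* s)) := c :* (i :* r :* s)) refl (i !) (cutFrom A 1 u v)
        (runFactorial (A ∷ u)) (runFactorial v))
      (cong (λ r → cutFrom A 1 u v * (r * runFactorial v)) (sym (runFactorial-run B i (A ∷ u) refl)))))
  where open +-*-Solver

runFactorial-++ : ∀ u v → runFactorial (u ++ v) ≡ cut u v * (runFactorial u * runFactorial v)
runFactorial-++ []      v = sym (trans (*-identityˡ _) (*-identityˡ _))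
runFactorial-++ (x ∷ u) v = runFactorial-cutFrom x 1 u v

lead-A-Bs : ∀ b → lead A (replicate b B) ≡ 0
lead-A-Bs zero    = refl
lead-A-Bs (suc b) = refl

runFactorial*X : ∀ u → fromℕ (runFactorial u) ℚ.* X u ≡ fromℕ (indicator u)
runFactorial*X u with X-view u
... | inj₂ (eq , zeros) = trans (cong (fromℕ (runFactorial u) ℚ.*_) eq)
    (trans (fromℕ-*0 (runFactorial u)) (cong fromℕ (sym zeros)))
... | inj₁ (a , b , refl , eq , one , _) = trans (cong₂ (λ r y → fromℕ r ℚ.* y) weight eq)
    (trans (fromℕ-*-1/[!*!] a b) (trans (sym fromℤ-1) (cong fromℕ (sym one))))
  where
  weight : runFactorial (replicate a A ++ replicate b B) ≡ a ! * b !
  weight = trans (runFactorial-run A a (replicate b B) (lead-A-Bs b)) (cong (a ! *_) (runFactorial-pure B b))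

-- The coefficient of w in X ^ k, multiplied by the factorials of the runs of w (see runFactorial*X^).
F : ℕ → Word → ℕ
F zero    []      = 1
F zero    (_ ∷ _) = 0
F (suc k) w       = sumSplits (λ u v → cut u v * (indicator u * F k v)) w

runFactorial*X^ : ∀ k w → fromℕ (runFactorial w) ℚ.* (X ^S k) w ≡ fromℕ (F k w)
runFactorial*X^ zero []      = ℚ.*-identityʳ (fromℕ 1)
runFactorial*X^ zero (x ∷ w) = fromℕ-*0 (runFactorial (x ∷ w))
runFactorial*X^ (suc k) w = ⊛-sumSplits (runFactorial w) X (X ^S k) _ w term
  where
  open ≡-Reasoning
  open ℚSolver
  term : ∀ u v → u ++ v ≡ w → fromℕ (runFactorial w) ℚ.* (X u ℚ.* (X ^S k) v) ≡ fromℕ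
      (cut u v * (indicator u * F k v))
  term u v refl = begin
    fromℕ (runFactorial (u ++ v)) ℚ.* (X u ℚ.* (X ^S k) v)
      ≡⟨ cong (λ r → fromℕ r ℚ.* (X u ℚ.* (X ^S k) v)) (runFactorial-++ u v) ⟩
    fromℕ (cut u v * (runFactorial u * runFactorial v)) ℚ.* (X u ℚ.* (X ^S k) v)
      ≡⟨ cong (ℚ._* (X u ℚ.* (X ^S k) v)) (trans (fromℕ-* (cut u v) _)
          (cong (fromℕ (cut u v) ℚ.*_) (fromℕ-* (runFactorial u) (runFactorial v)))) ⟩
    fromℕ (cut u v) ℚ.* (fromℕ (runFactorial u) ℚ.* fromℕ (runFactorial v)) ℚ.* (X u ℚ.* (X ^S k) v)
      ≡⟨ solve 5 (λ c a b x y → c :* (a :* b) :* (x :* y) := c :* ((a :* x) :* (b :* y))) refl (fromℕ (cut u v))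
          (fromℕ (runFactorial u)) (fromℕ (runFactorial v)) (X u) ((X ^S k) v) ⟩
    fromℕ (cut u v) ℚ.* ((fromℕ (runFactorial u) ℚ.* X u) ℚ.* (fromℕ (runFactorial v) ℚ.* (X ^S k) v))
      ≡⟨ cong (fromℕ (cut u v) ℚ.*_) (cong₂ ℚ._*_ (runFactorial*X u) (runFactorial*X^ k v)) ⟩
    fromℕ (cut u v) ℚ.* (fromℕ (indicator u) ℚ.* fromℕ (F k v))
      ≡⟨ sym (trans (fromℕ-* (cut u v) _) (cong (fromℕ (cut u v) ℚ.*_) (fromℕ-* (indicator u) (F k v)))) ⟩
    fromℕ (cut u v * (indicator u * F k v)) ∎

-- Recurrences for F along a run

∑ : ℕ → (ℕ → ℕ) → ℕ
∑ zero    f = 0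
∑ (suc n) f = f 0 + ∑ n (f ∘ suc)

∑-cong : ∀ n {f g} → (∀ i → i < n → f i ≡ g i) → ∑ n f ≡ ∑ n g
∑-cong zero    eq = refl
∑-cong (suc n) eq = cong₂ _+_ (eq 0 (s≤s z≤n)) (∑-cong n λ i i<n → eq (suc i) (s≤s i<n))

∑-last : ∀ n f → ∑ (suc n) f ≡ ∑ n f + f n
∑-last zero    f = +-identityʳ (f 0)
∑-last (suc n) f = trans (cong (λ z → f 0 + z) (∑-last n (f ∘ suc))) (sym (+-assoc (f 0) _ _))

∑-+ : ∀ n f g → ∑ n (λ i → f i + g i) ≡ ∑ n f + ∑ n g
∑-+ zero    f g = refl
∑-+ (suc n) f g = trans (cong (λ x → f 0 + g 0 + x) (∑-+ n (f ∘ suc) (g ∘ suc)))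
  (solve 4 (λ a b c d → a :+ b :+ (c :+ d) := a :+ c :+ (b :+ d)) refl (f 0) (g 0) (∑ n (f ∘ suc)) (∑ n (g ∘ suc)))
  where open +-*-Solver

∑-*ʳ : ∀ n f c → ∑ n (λ i → f i * c) ≡ ∑ n f * c
∑-*ʳ zero    f c = refl
∑-*ʳ (suc n) f c = trans (cong (λ z → f 0 * c + z) (∑-*ʳ n (f ∘ suc) c)) (sym (*-distribʳ-+ c (f 0) _))

∑-∣ : ∀ d n f → (∀ i → i < n → d ∣ f i) → d ∣ ∑ n f
∑-∣ d zero    f div = d ∣0
∑-∣ d (suc n) f div = ∣m∣n⇒∣m+n (div 0 (s≤s z≤n)) (∑-∣ d n (f ∘ suc) λ i i<n → div (suc i) (s≤s i<n))

sumSplits-replicate : ∀ t x q v → sumSplits t (replicate q x ++ v) ≡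
  ∑ q (λ i → t (replicate i x) (replicate (q ∸ i) x ++ v)) + sumSplits (λ u → t (replicate q x ++ u)) v
sumSplits-replicate t x zero    v = refl
sumSplits-replicate t x (suc q) v = trans (sumSplits-∷ t x (replicate q x ++ v))
  (trans (cong (λ z → t [] (x ∷ replicate q x ++ v) + z) (sumSplits-replicate (λ u → t (x ∷ u)) x q v))
      (sym (+-assoc (t [] (x ∷ replicate q x ++ v)) _ _)))

sumSplits-0 : ∀ t w → (∀ u v → t u v ≡ 0) → sumSplits t w ≡ 0
sumSplits-0 t []      eq = trans (+-identityʳ _) (eq [] [])
sumSplits-0 t (x ∷ w) eq = trans (sumSplits-∷ t x w)
    (cong₂ _+_ (eq [] (x ∷ w)) (sumSplits-0 (λ u → t (x ∷ u)) w λ u → eq (x ∷ u)))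

-- The binomial transform without its term f q: the first factor of X ^ k takes suc i ≥ 1 of the q
-- letters of a run.
binomSum : (ℕ → ℕ) → ℕ → ℕ
binomSum f q = ∑ q (λ i → (q C suc i) * f (q ∸ suc i))

cutTerm : ℕ → Word → Word → ℕ
cutTerm k u v = cut u v * (indicator u * F k v)

-- The value 0 at j = 0, instead of F k v, takes the cut at the end of the run out of `binomSum`.
-- That cut is counted separately, and the vanishing at 0 is what the later recurrences rely on.
runSeq : ℕ → Letter → Word → ℕ → ℕ
runSeq k x v zero    = 0
runSeq k x v (suc j) = F k (replicate (suc j) x ++ v)

cutFrom-replicate : ∀ x j i v → cutFrom x j (replicate i x) v ≡ ((j + i + lead x v) C (j + i))
cutFrom-replicate x j zero    v = cong (λ m → (m + lead x v) C m) (sym (+-identityʳ j))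
cutFrom-replicate A j (suc i) v = trans (cutFrom-replicate A (suc j) i v)
    (cong (λ m → (m + lead A v) C m) (sym (+-suc j i)))
cutFrom-replicate B j (suc i) v = trans (cutFrom-replicate B (suc j) i v)
    (cong (λ m → (m + lead B v) C m) (sym (+-suc j i)))

cutFrom-A-B : ∀ i a u v → cutFrom A i (replicate a A ++ B ∷ u) v ≡ cutFrom B 1 u v
cutFrom-A-B i zero    u v = refl
cutFrom-A-B i (suc a) u v = cutFrom-A-B (suc i) a u v

cut-A-B : ∀ a u v → cut (replicate a A ++ B ∷ u) v ≡ cutFrom B 1 u v
cut-A-B zero    u v = refl
cut-A-B (suc a) u v = cutFrom-A-B 1 a u v

isBs-replicate : ∀ b → isBs (replicate b B) ≡ 1
isBs-replicate zero    = refl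
isBs-replicate (suc b) = isBs-replicate b

isBs-B-A : ∀ b u → isBs (replicate b B ++ A ∷ u) ≡ 0
isBs-B-A zero    u = refl
isBs-B-A (suc b) u = isBs-B-A b u

isABs-A : ∀ a → isABs (replicate a A) ≡ 1
isABs-A zero    = refl
isABs-A (suc a) = isABs-A a

isABs-A-B : ∀ a u → isABs (replicate a A ++ B ∷ u) ≡ isBs u
isABs-A-B zero    u = refl
isABs-A-B (suc a) u = isABs-A-B a u

indicator-A-B : ∀ a u → indicator (replicate a A ++ B ∷ u) ≡ isBs u
indicator-A-B zero    u = refl
indicator-A-B (suc a) u = isABs-A-B a u

cutTerm-A : ∀ k j v → cutTerm k (replicate (suc j) A) v ≡ ((suc j + lead A v) C suc j) * F k v
cutTerm-A k j v = cong₂ _*_ (cutFrom-replicate A 1 j v) (trans (cong (_* F k v) (isABs-A j)) (*-identityˡ (F k v)))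

cutTerm-AB : ∀ k a j v → cutTerm k (replicate a A ++ replicate (suc j) B) v ≡ ((suc j + lead B v) C suc j) * F k v
cutTerm-AB k a j v = cong₂ _*_ (trans (cut-A-B a (replicate j B) v) (cutFrom-replicate B 1 j v))
  (trans (cong (_* F k v) (trans (indicator-A-B a (replicate j B)) (isBs-replicate j))) (*-identityˡ (F k v)))

cutTerm-ABA : ∀ k a b u v → cutTerm k (replicate a A ++ (replicate (suc b) B ++ A ∷ u)) v ≡ 0
cutTerm-ABA k a b u v = trans (cong (λ i → c * (i * F k v))
    (trans (indicator-A-B a (replicate b B ++ A ∷ u)) (isBs-B-A b u))) (*-zeroʳ c)
  where c = cut (replicate a A ++ (replicate (suc b) B ++ A ∷ u)) v

whole-run : ∀ k x j v → lead x v ≡ 0 → ((suc j + lead x v) C suc j) * F k v ≡ F k v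
whole-run k x j v eq = trans (cong (λ m → ((suc j + m) C suc j) * F k v) eq)
  (trans (cong (_* F k v) (n+0Cn≡1 (suc j))) (*-identityˡ (F k v)))

∑-run : ∀ k x pre q v → lead x v ≡ 0 →
  (∀ j v′ → cutTerm k (pre ++ replicate (suc j) x) v′ ≡ ((suc j + lead x v′) C suc j) * F k v′) →
  ∑ (suc q) (λ i → cutTerm k (pre ++ replicate i x) (replicate (suc q ∸ i) x ++ v))
    ≡ cutTerm k (pre ++ []) (replicate (suc q) x ++ v) + binomSum (runSeq k x v) (suc q)
∑-run k x pre q v lead≡0 val = cong (λ z → cutTerm k (pre ++ []) (replicate (suc q) x ++ v) + z)
  (trans (∑-cong q same) (sym (trans (∑-last q _) (trans (cong (λ z → ∑ q f + z) last≡0) (+-identityʳ _)))))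
  where
  f : ℕ → ℕ
  f i = (suc q C suc i) * runSeq k x v (suc q ∸ suc i)
  last≡0 : f q ≡ 0
  last≡0 = trans (cong (λ m → (suc q C suc q) * runSeq k x v m) (n∸n≡0 q)) (*-zeroʳ (suc q C suc q))
  runSeq-pos : ∀ m → 0 < m → F k (replicate m x ++ v) ≡ runSeq k x v m
  runSeq-pos (suc m) _ = refl
  same : ∀ i → i < q → cutTerm k (pre ++ replicate (suc i) x) (replicate (q ∸ i) x ++ v) ≡ f i
  same i i<q = trans (val i _) (cong₂ (λ m y → (m C suc i) * y)
    (cong suc (trans (cong (λ z → i + z) (trans (lead-replicate x (q ∸ i) v)
        (trans (cong (λ z → q ∸ i + z) lead≡0) (+-identityʳ _)))) (m+[n∸m]≡n (<⇒≤ i<q))))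
    (runSeq-pos (q ∸ i) (m<n⇒0<n∸m i<q)))

-- The first factor may consist of a letters A, already passed, followed by letters B. A cut beyond
-- the run of B's contributes 0, because the piece would have an A after a B.
sumSplits-B : ∀ k a r v → lead B v ≡ 0 → sumSplits (λ u → cutTerm k (replicate a A ++ u)) (replicate (suc r) B ++ v)
  ≡ cutTerm k (replicate a A ++ []) (replicate (suc r) B ++ v) + (binomSum (runSeq k B v) (suc r) + F k v)
sumSplits-B k a r v lead≡0 = trans (sumSplits-replicate (λ u → cutTerm k (replicate a A ++ u)) B (suc r) v)
  (trans (cong₂ _+_ (∑-run k B (replicate a A) r v lead≡0 (cutTerm-AB k a)) (after v lead≡0))
    (+-assoc (cutTerm k (replicate a A ++ []) (replicate (suc r) B ++ v)) (binomSum (runSeq k B v) (suc r))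
        (F k v)))
  where
  atStart : ∀ v → lead B v ≡ 0 → cutTerm k (replicate a A ++ (replicate (suc r) B ++ [])) v ≡ F k v
  atStart v eq = trans (cong (λ u → cutTerm k (replicate a A ++ u) v) (++-identityʳ (replicate (suc r) B)))
    (trans (cutTerm-AB k a r v) (whole-run k B r v eq))
  after : ∀ v → lead B v ≡ 0 → sumSplits (λ u → cutTerm k (replicate a A ++ (replicate (suc r) B ++ u))) v ≡ F k v
  after []      eq = trans (+-identityʳ _) (atStart [] eq)
  after (A ∷ v) eq = trans (sumSplits-∷ (λ u → cutTerm k (replicate a A ++ (replicate (suc r) B ++ u))) A v)
      (trans (cong₂ _+_ (atStart (A ∷ v) eq)
    (sumSplits-0 (λ u → cutTerm k (replicate a A ++ (replicate (suc r) B ++ A ∷ u))) v (cutTerm-ABA k a r)))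
        (+-identityʳ _))

F-B : ∀ k r v → lead B v ≡ 0 → F (suc k) (replicate (suc r) B ++ v) ≡ binomSum (runSeq k B v) (suc r) + F k v
F-B k r v eq = sumSplits-B k 0 r v eq

sumSplits-A : ∀ k q v → lead A v ≡ 0 → F (suc k) (replicate (suc q) A ++ v)
  ≡ binomSum (runSeq k A v) (suc q) + sumSplits (λ u → cutTerm k (replicate (suc q) A ++ u)) v
sumSplits-A k q v eq = trans (sumSplits-replicate (cutTerm k) A (suc q) v)
  (cong (_+ sumSplits (λ u → cutTerm k (replicate (suc q) A ++ u)) v) (∑-run k A [] q v eq (cutTerm-A k)))

F-A : ∀ k q → F (suc k) (replicate (suc q) A ++ []) ≡ binomSum (runSeq k A []) (suc q) + F k []
F-A k q = trans (sumSplits-A k q [] refl) (cong (λ z → binomSum (runSeq k A []) (suc q) + z)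
  (trans (+-identityʳ _) (trans (cong (λ u → cutTerm k u []) (++-identityʳ (replicate (suc q) A)))
    (trans (cutTerm-A k q []) (whole-run k A q [] refl)))))

-- The four summands: the first factor ends inside the A-run, at its end, inside the B-run, or at
-- its end. A cut after the A-run takes that run as a whole, so the last three summands do not
-- depend on q.
F-AB : ∀ k q r v → lead B v ≡ 0 → let w = replicate (suc r) B ++ v in
  F (suc k) (replicate (suc q) A ++ w) ≡ binomSum (runSeq k A w) (suc q) +
      (F k w + (binomSum (runSeq k B v) (suc r) + F k v))
F-AB k q r v eq = trans (sumSplits-A k q (replicate (suc r) B ++ v) refl)
  (cong (λ z → binomSum (runSeq k A (replicate (suc r) B ++ v)) (suc q) + z) (trans (sumSplits-B k (suc q) r v eq)
    (cong (_+ (binomSum (runSeq k B v) (suc r) + F k v))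
        (trans (cong (λ u → cutTerm k u (replicate (suc r) B ++ v)) (++-identityʳ (replicate (suc q) A)))
      (trans (cutTerm-A k q (replicate (suc r) B ++ v)) (whole-run k A q (replicate (suc r) B ++ v) refl))))))

-- The binomial transform and surjection numbers

binomSum-cong : ∀ {f g} q → (∀ i → f i ≡ g i) → binomSum f q ≡ binomSum g q
binomSum-cong q eq = ∑-cong q λ i _ → cong ((q C suc i) *_) (eq (q ∸ suc i))

binomSum-+ : ∀ f g q → binomSum (λ i → f i + g i) q ≡ binomSum f q + binomSum g q
binomSum-+ f g q = trans (∑-cong q λ i _ → *-distribˡ-+ (q C suc i) (f (q ∸ suc i)) (g (q ∸ suc i)))
  (∑-+ q (λ i → (q C suc i) * f (q ∸ suc i)) (λ i → (q C suc i) * g (q ∸ suc i)))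

binomSum-*ʳ : ∀ f c q → binomSum (λ i → f i * c) q ≡ binomSum f q * c
binomSum-*ʳ f c q = trans (∑-cong q λ i _ → sym (*-assoc (q C suc i) (f (q ∸ suc i)) c)) (∑-*ʳ q _ c)

binomSum-0 : ∀ q → binomSum (λ _ → 0) q ≡ 0
binomSum-0 q = trans (binomSum-*ʳ (λ _ → 0) 0 q) (*-zeroʳ (binomSum (λ _ → 0) q))

-- Pascal's rule: the binomial transform q ↦ f q + binomSum f q turns the shift operator S into 1 + S.
binomSum-shift : ∀ f q → f (suc q) + binomSum f (suc q) ≡ (f q + binomSum f q) + (f (suc q) + binomSum (f ∘ suc) q)
binomSum-shift f q = begin
  f (suc q) + ∑ (suc q) (λ i → (suc q C suc i) * f (q ∸ i))
    ≡⟨ cong (λ z → f (suc q) + z) (trans (∑-cong (suc q) λ i _ → trans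
        (cong (_* f (q ∸ i)) (sym (nCk+nC[k+1]≡[n+1]C[k+1] q i)))
        (*-distribʳ-+ (f (q ∸ i)) (q C i) (q C suc i)))
        (∑-+ (suc q) (λ i → (q C i) * f (q ∸ i)) (λ i → (q C suc i) * f (q ∸ i)))) ⟩
  f (suc q) + (1 * f q + binomSum f q + ∑ (suc q) (λ i → (q C suc i) * f (q ∸ i)))
    ≡⟨ cong (λ x → f (suc q) + (1 * f q + binomSum f q + x)) shifted ⟩
  f (suc q) + (1 * f q + binomSum f q + binomSum (f ∘ suc) q)
    ≡⟨ solve 4 (λ a b c d → a :+ (con 1 :* b :+ c :+ d) := (b :+ c) :+ (a :+ d)) refl (f (suc q)) (f q)
        (binomSum f q) (binomSum (f ∘ suc) q) ⟩
  (f q + binomSum f q) + (f (suc q) + binomSum (f ∘ suc) q) ∎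
  where
  open ≡-Reasoning
  open +-*-Solver
  shifted : ∑ (suc q) (λ i → (q C suc i) * f (q ∸ i)) ≡ binomSum (f ∘ suc) q
  shifted = trans (∑-last q (λ i → (q C suc i) * f (q ∸ i)))
    (trans (cong₂ _+_ (∑-cong q λ i i<q → cong (λ m → (q C suc i) * f m) (+-∸-assoc 1 i<q))
      (cong (_* f (q ∸ q)) (k>n⇒nCk≡0 (n<1+n q)))) (+-identityʳ _))

binomial : ∀ x q → x ^ q + binomSum (x ^_) q ≡ suc x ^ q
binomial x zero    = refl
binomial x (suc q) = trans (binomSum-shift (x ^_) q)
  (cong₂ _+_ (binomial x q)
    (trans (cong (λ z → x * x ^ q + z) (trans (binomSum-cong q λ i → *-comm x (x ^ i))
        (trans (binomSum-*ʳ (x ^_) x q) (*-comm _ x))))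
      (trans (sym (*-distribˡ-+ x (x ^ q) _)) (cong (x *_) (binomial x q)))))

-- The number of surjections from a q-element set onto a j-element set.
surj : ℕ → ℕ → ℕ
surj zero    q = 0 ^ q
surj (suc j) q = binomSum (surj j) q

surj-1 : ∀ q → surj 1 (suc q) ≡ 1
surj-1 q = trans (∑-last q (λ i → (suc q C suc i) * 0 ^ (q ∸ i)))
  (cong₂ _+_ (trans (∑-cong q λ i i<q → trans (cong ((suc q C suc i) *_) (0^ (q ∸ i) (m<n⇒0<n∸m i<q)))
      (*-zeroʳ (suc q C suc i))) (binomSum-0′ q))
    (trans (cong₂ _*_ (nCn≡1 (suc q)) (cong (0 ^_) (n∸n≡0 q))) refl))
  where
  0^ : ∀ m → 0 < m → 0 ^ m ≡ 0
  0^ (suc m) _ = refl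
  binomSum-0′ : ∀ n → ∑ n (λ _ → 0) ≡ 0
  binomSum-0′ zero    = refl
  binomSum-0′ (suc n) = binomSum-0′ n

-- surjConv β j k q = Σ_{i < k} surj (j + i) q · β (k − 1 − i)
surjConv : (ℕ → ℕ) → ℕ → ℕ → ℕ → ℕ
surjConv β j zero    q = 0
surjConv β j (suc k) q = surj j q * β k + surjConv β (suc j) k q

surjConv-suc : ∀ β j k q → surjConv β (suc j) k q ≡ binomSum (surjConv β j k) q
surjConv-suc β j zero    q = sym (binomSum-0 q)
surjConv-suc β j (suc k) q = trans (cong₂ _+_ (sym (binomSum-*ʳ (surj j) (β k) q)) (surjConv-suc β (suc j) k q))
  (sym (binomSum-+ (λ i → surj j i * β k) (surjConv β (suc j) k) q))

-- The inhomogeneity β k is present only for positive q, hence enters as surj 1 q · β k; each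
-- further level applies `binomSum`, which raises the index of `surj` by one.
recurrence-solution : ∀ (a : ℕ → ℕ → ℕ) β → (∀ q → a 0 q ≡ 0) → (∀ k → a k 0 ≡ 0) →
  (∀ k q → a (suc k) (suc q) ≡ binomSum (a k) (suc q) + β k) → ∀ k q → a k q ≡ surjConv β 1 k q
recurrence-solution a β a₀ a⁰ rec zero    q       = a₀ q
recurrence-solution a β a₀ a⁰ rec (suc k) zero    = trans (a⁰ (suc k)) (sym (surjConv-suc β 0 (suc k) 0))
recurrence-solution a β a₀ a⁰ rec (suc k) (suc q) = trans (rec k q)
  (trans (cong (_+ β k) (trans (binomSum-cong (suc q) (recurrence-solution a β a₀ a⁰ rec k))
      (sym (surjConv-suc β 1 k (suc q)))))
    (trans (+-comm _ (β k)) (cong (_+ surjConv β 2 k (suc q))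
        (sym (trans (cong (_* β k) (surj-1 q)) (*-identityˡ (β k)))))))

-- The table of Σ_i (x choose i) surj (j + i) q; its column j = 0 consists of the powers x ^ q.
surjTable : ℕ → ℕ → ℕ → ℕ
surjTable zero    j q = surj j q
surjTable (suc x) j q = surjTable x j q + surjTable x (suc j) q

surjTable-suc : ∀ x j q → surjTable x (suc j) q ≡ binomSum (surjTable x j) q
surjTable-suc zero    j q = refl
surjTable-suc (suc x) j q = trans (cong₂ _+_ (surjTable-suc x j q) (surjTable-suc x (suc j) q))
  (sym (binomSum-+ (surjTable x j) (surjTable x (suc j)) q))

-- Combinatorially, the x ^ q maps from q points to x points are sorted by their image.
surjTable-0 : ∀ x q → surjTable x 0 q ≡ x ^ q
surjTable-0 zero    q = refl
surjTable-0 (suc x) q = trans (cong₂ _+_ (surjTable-0 x q)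
    (trans (surjTable-suc x 0 q) (binomSum-cong q (surjTable-0 x)))) (binomial x q)

-- Congruences modulo p

module Congruence (q : ℕ) (pr : Prime (2 + q)) where
  open Local q pr public

  infix 4 _≋_

  -- A multiple of p on each side keeps congruence inside ℕ, and cancellation of summands is
  -- inherited from ℕ.
  record _≋_ (a b : ℕ) : Set where
    constructor cong-by
    field
      {m n}    : ℕ
      equation : a + p * m ≡ b + p * n

  ≋-reflexive : ∀ {a b} → a ≡ b → a ≋ b
  ≋-reflexive eq = cong-by {m = 0} {0} (cong (_+ p * 0) eq)

  ≋-refl : ∀ {a} → a ≋ a
  ≋-refl = ≋-reflexive refl

  ≋-sym : ∀ {a b} → a ≋ b → b ≋ a
  ≋-sym (cong-by {m} {n} eq) = cong-by {m = n} {m} (sym eq)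

  ≋-trans : ∀ {a b c} → a ≋ b → b ≋ c → a ≋ c
  ≋-trans {a} {b} {c} (cong-by {m} {n} eq) (cong-by {m′} {n′} eq′) = cong-by {m = m + m′} {n + n′} (begin
    a + p * (m + m′)        ≡⟨ solve 4 (λ a p m n → a :+ p :* (m :+ n) := a :+ p :* m :+ p :* n) refl a p m m′ ⟩
    a + p * m + p * m′      ≡⟨ cong (_+ p * m′) eq ⟩
    b + p * n + p * m′      ≡⟨ solve 4 (λ b p n m → b :+ p :* n :+ p :* m := b :+ p :* m :+ p :* n) refl b p n m′ ⟩
    b + p * m′ + p * n      ≡⟨ cong (_+ p * n) eq′ ⟩
    c + p * n′ + p * n      ≡⟨ solve 4 (λ c p n m → c :+ p :* n :+ p :* m := c :+ p :* (m :+ n)) refl c p n′ n ⟩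
    c + p * (n + n′)        ∎)
    where
    open ≡-Reasoning
    open +-*-Solver

  ≋-+ : ∀ {a b c d} → a ≋ b → c ≋ d → a + c ≋ b + d
  ≋-+ {a} {b} {c} {d} (cong-by {m} {n} eq) (cong-by {m′} {n′} eq′) = cong-by {m = m + m′} {n + n′}
    (trans (exchange a c m m′) (trans (cong₂ _+_ eq eq′) (sym (exchange b d n n′))))
    where
    open +-*-Solver
    exchange : ∀ a c m m′ → a + c + p * (m + m′) ≡ (a + p * m) + (c + p * m′)
    exchange = solve 4 (λ a c m m′ → a :+ c :+ con p :* (m :+ m′) := (a :+ con p :* m) :+ (c :+ con p :* m′)) refl

  ≋-*ˡ : ∀ c {a b} → a ≋ b → c * a ≋ c * b
  ≋-*ˡ c {a} {b} (cong-by {m} {n} eq) = cong-by {m = c * m} {c * n}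
      (trans (factored a m) (trans (cong (c *_) eq) (sym (factored b n))))
    where
    open +-*-Solver
    factored : ∀ a m → c * a + p * (c * m) ≡ c * (a + p * m)
    factored a m = solve 4 (λ c a p m → c :* a :+ p :* (c :* m) := c :* (a :+ p :* m)) refl c a p m

  ≋-cancelˡ : ∀ x {a b} → x + a ≋ x + b → a ≋ b
  ≋-cancelˡ x {a} {b} (cong-by {m} {n} eq) = cong-by {m = m} {n}
      (+-cancelˡ-≡ x _ _ (trans (sym (+-assoc x a _)) (trans eq (+-assoc x b _))))

  ∣⇒≋0 : ∀ {a} → p ∣ a → a ≋ 0
  ∣⇒≋0 {a} (divides k eq) = cong-by {m = 0} {k}
      (trans (cong (_+ p * 0) eq) (trans (cong (λ z → k * p + z) (*-zeroʳ p)) (trans (+-identityʳ _) (*-comm k p))))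

  ≋0⇒∣ : ∀ {a} → a ≋ 0 → p ∣ a
  ≋0⇒∣ {a} (cong-by {m} {n} eq) = ∣m+n∣m⇒∣n (subst (p ∣_) (trans (sym eq) (+-comm a (p * m))) (m∣m*n n)) (m∣m*n m)

  -- The digit sum of p ^ e is 1, while its two nonzero parts have digit sum at least 1 each; so
  -- there is a carry.
  p∣p^C : ∀ e i → suc i < p ^ e → p ∣ ((p ^ e) C suc i)
  p∣p^C e i i<p^e = go (C-valuation (suc i) j)
    where
    j = p ^ e ∸ suc i
    sum≡ : suc i + j ≡ p ^ e
    sum≡ = m+[n∸m]≡n (<⇒≤ i<p^e)
    go : (∃ λ f → p ^ f ∣ ((suc i + j) C suc i) × s p (suc i) + s p j ≡ s p (suc i + j) + suc q * f) → p ∣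
        ((p ^ e) C suc i)
    go (suc f , div , _) = ∣-trans (m∣m*n (p ^ f)) (subst (λ m → p ^ suc f ∣ m C suc i) sum≡ div)
    go (zero , _ , carries) = contradiction
      (≤-trans (+-mono-≤ (s-pos (suc i) (s≤s z≤n)) (s-pos j (m<n⇒0<n∸m i<p^e)))
        (≤-reflexive (trans carries (cong₂ _+_ (trans (cong (s p) sum≡) (s-pow e)) (*-zeroʳ (suc q))))))
      1+n≰n

  -- Of the binomial coefficients only (p ^ e choose p ^ e) = 1 survives. For f = `runSeq k x v` the
  -- result is 0: modulo p, such a run is never cut in its interior.
  binomSum-p^≋ : ∀ f e r → p ^ e ≡ suc r → binomSum f (suc r) ≋ f 0
  binomSum-p^≋ f e r eq = ≋-trans (≋-reflexive (∑-last r (λ i → (suc r C suc i) * f (r ∸ i))))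
    (≋-+ (∣⇒≋0 (∑-∣ p r _ λ i i<r → ∣m⇒∣m*n (f (r ∸ i))
        (subst (λ m → p ∣ m C suc i) eq (p∣p^C e i (≤-trans (s≤s i<r) (≤-reflexive (sym eq)))))))
      (≋-reflexive (trans (cong₂ (λ c m → c * f m) (nCn≡1 (suc r)) (n∸n≡0 r)) (*-identityˡ (f 0)))))

  fermat : ∀ x → x ^ p ≋ x
  fermat zero    = ≋-refl
  fermat (suc x) = ≋-trans (≋-reflexive (sym (binomial x p)))
    (≋-trans (≋-+ (fermat x) (binomSum-p^≋ (x ^_) 1 (suc q) (*-identityʳ p))) (≋-reflexive (+-comm x 1)))

  fermat-iterated : ∀ x b → x ^ suc (b * suc q) ≋ x
  fermat-iterated x zero    = ≋-reflexive (*-identityʳ x)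
  fermat-iterated x (suc b) = ≋-trans (≋-reflexive exponents)
    (≋-trans (≋-*ˡ (x ^ (b * suc q)) (fermat x))
        (≋-trans (≋-reflexive (*-comm (x ^ (b * suc q)) x)) (fermat-iterated x b)))
    where
    exponents : x ^ suc (suc q + b * suc q) ≡ x ^ (b * suc q) * x ^ p
    exponents = trans (cong (x ^_) (+-comm p (b * suc q))) (^-distribˡ-+-* x (b * suc q) p)

  -- By definition each column consists of the differences of the previous one. For Q ≡ 1 modulo p -
  -- 1 the first column is x ^ Q ≋ x, so the next is 1 and all later ones vanish.
  surjTable≋0 : ∀ b x j → surjTable x (2 + j) (suc (b * suc q)) ≋ 0
  surjTable≋0 b = go
    where
    Q = suc (b * suc q)
    power : ∀ x → surjTable x 0 Q ≋ x
    power x = ≋-trans (≋-reflexive (surjTable-0 x Q)) (fermat-iterated x b)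
    one : ∀ x → surjTable x 1 Q ≋ 1
    one x = ≋-cancelˡ x (≋-trans (≋-trans (≋-+ (≋-sym (power x)) ≋-refl) (power (suc x)))
        (≋-reflexive (+-comm 1 x)))
    go : ∀ x j → surjTable x (2 + j) Q ≋ 0
    go x zero    = ≋-cancelˡ 1 (≋-trans (≋-+ (≋-sym (one x)) ≋-refl) (one (suc x)))
    go x (suc j) = ≋-trans (≋-+ (≋-sym (go x j)) ≋-refl) (go (suc x) j)

  surjConv≋0 : ∀ b β j k → surjConv β (2 + j) k (suc (b * suc q)) ≋ 0
  surjConv≋0 b β j zero    = ≋-refl
  surjConv≋0 b β j (suc k) = ≋-+ (≋-trans (≋-trans (≋-reflexive (*-comm (surj (2 + j) (suc (b * suc q))) (β k)))
      (≋-*ˡ (β k) (surjTable≋0 b 0 j))) (≋-reflexive (*-zeroʳ (β k))))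
    (surjConv≋0 b β (suc j) k)

  -- Only the summand with surj 1 = 1 survives, so a run of length 1 modulo p - 1 behaves like a run
  -- of length 1, for which the `binomSum` term vanishes.
  recurrence≋ : ∀ b (a : ℕ → ℕ → ℕ) β → (∀ q → a 0 q ≡ 0) → (∀ k → a k 0 ≡ 0) →
    (∀ k q → a (suc k) (suc q) ≡ binomSum (a k) (suc q) + β k) → ∀ k → a (suc k) (suc (b * suc q)) ≋ β k
  recurrence≋ b a β a₀ a⁰ rec k = ≋-trans (≋-reflexive
      (recurrence-solution a β a₀ a⁰ rec (suc k) (suc (b * suc q))))
    (≋-trans (≋-+ (≋-reflexive (trans (cong (_* β k) (surj-1 (b * suc q))) (*-identityˡ (β k))))
        (surjConv≋0 b β 0 k)) (≋-reflexive (+-identityʳ (β k))))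

-- Cutting an alternating word

-- The number of ways to cut the word ABAB... of m letters into k pieces A, B or AB: at the front
-- stand either A and B as two pieces or AB as one.
R : ℕ → ℕ → ℕ
R zero          zero          = 1
R zero          (suc k)       = 0
R (suc m)       zero          = 0
R (suc zero)    (suc k)       = R zero k
R (suc (suc m)) (suc zero)    = R m zero
R (suc (suc m)) (suc (suc k)) = R m k + R m (suc k)

R-0 : ∀ m k → m < k → R m k ≡ 0
R-0 zero          (suc k)       _ = refl
R-0 (suc zero)    (suc (suc k)) _ = refl
R-0 (suc zero)    (suc zero)    (s≤s ())
R-0 (suc (suc m)) (suc zero)    (s≤s ())
R-0 (suc (suc m)) (suc (suc k)) (s≤s (s≤s m<k)) = cong₂ _+_ (R-0 m k m<k) (R-0 m (suc k) (m<n⇒m<1+n m<k))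

-- Each of the ⌊ m /2⌋ pairs AB is one piece or two; k + c letters give k pieces when exactly c
-- pairs stay whole.
R-closed : ∀ k c → R (k + c) k ≡ ⌊ k + c /2⌋ C c
R-closed zero          zero          = refl
R-closed zero          (suc c)       = sym (k>n⇒nCk≡0 (⌊n/2⌋<n c))
R-closed (suc zero)    zero          = refl
R-closed (suc zero)    (suc zero)    = refl
R-closed (suc zero)    (suc (suc c)) = sym (k>n⇒nCk≡0 (s≤s (⌊n/2⌋<n c)))
R-closed (suc (suc k)) zero          = cong₂ _+_ (R-closed k zero)
    (R-0 (k + 0) (suc k) (s≤s (≤-reflexive (+-identityʳ k))))
R-closed (suc (suc k)) (suc c)       = trans (cong₂ _+_ (R-closed k (suc c))
    (trans (cong (λ m → R m (suc k)) (+-suc k c))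
        (trans (R-closed (suc k) c) (cong (λ m → ⌊ m /2⌋ C c) (sym (+-suc k c))))))
  (trans (+-comm (⌊ k + suc c /2⌋ C suc c) (⌊ k + suc c /2⌋ C c)) (nCk+nC[k+1]≡[n+1]C[k+1] ⌊ k + suc c /2⌋ c))

C-suc : ∀ i j → ((i + suc j) C suc i) * suc i ≡ ((i + suc j) C i) * suc j
C-suc i j = *-cancelʳ-≡ _ _ (i ! * j !) {{i !* j !≢0}} (begin
  C₁ * suc i * (i ! * j !)       ≡⟨ solve 4 (λ c i x y → c :* i :* (x :* y) := c :* (i :* x :* y)) refl C₁
      (suc i) (i !) (j !) ⟩
  C₁ * (suc i ! * j !)           ≡⟨ cong (λ m → (m C suc i) * (suc i ! * j !)) (+-suc i j) ⟩
  ((suc i + j) C suc i) * (suc i ! * j !) ≡⟨ C-factorials (suc i) j ⟩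
  (suc i + j) !                  ≡⟨ cong _! (sym (+-suc i j)) ⟩
  (i + suc j) !                  ≡⟨ sym (C-factorials i (suc j)) ⟩
  C₀ * (i ! * suc j !)           ≡⟨ solve 4 (λ c j x y → c :* (x :* (j :* y)) := c :* j :* (x :* y)) refl C₀
      (suc j) (i !) (j !) ⟩
  C₀ * suc j * (i ! * j !)       ∎)
  where
  open ≡-Reasoning
  open +-*-Solver
  C₀ = (i + suc j) C i
  C₁ = (i + suc j) C suc i

⌊n+n+m/2⌋ : ∀ n m → ⌊ n + n + m /2⌋ ≡ n + ⌊ m /2⌋
⌊n+n+m/2⌋ zero    m = refl
⌊n+n+m/2⌋ (suc n) m = trans (cong (λ x → ⌊ suc x + m /2⌋) (+-suc n n)) (cong suc (⌊n+n+m/2⌋ n m))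

even⊎odd : ∀ n → (∃ λ g → n ≡ g + g) ⊎ (∃ λ g → n ≡ suc (g + g))
even⊎odd zero = inj₁ (0 , refl)
even⊎odd (suc n) with even⊎odd n
... | inj₁ (g , eq) = inj₂ (g , cong suc eq)
... | inj₂ (g , eq) = inj₁ (suc g , trans (cong suc eq) (cong suc (sym (+-suc g g))))

-- Block words modulo p

module Blocks (q : ℕ) (pr : Prime (2 + q)) where
  open LocalSum q pr public
  open Congruence q pr public using (_≋_; cong-by; ≋-refl; ≋-trans; ≋-sym; ≋-reflexive; ≋-+; ≋0⇒∣; ∣⇒≋0;
      binomSum-p^≋; recurrence≋)

  flip : Letter → Letter
  flip A = B
  flip B = A

  powerWord : Letter → List ℕ → Word
  powerWord x []       = []
  powerWord x (e ∷ es) = replicate (p ^ e) x ++ powerWord (flip x) es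

  blockWord : ℕ → List ℕ → Word
  blockWord b es = replicate (suc (b * suc q)) A ++ powerWord B es

  p^-pred : ∀ e → ∃ λ r → p ^ e ≡ suc r
  p^-pred e with p ^ e | m^n>0 p e
  ... | suc r | _ = r , refl

  -- This makes a power of p admissible as a first block, so what remains after two blocks is again
  -- a `blockWord`.
  p^≡1+ : ∀ e → ∃ λ b → p ^ e ≡ suc (b * suc q)
  p^≡1+ zero = 0 , refl
  p^≡1+ (suc e) with p^≡1+ e
  ... | b , eq = suc (b + b * suc q) , trans (cong (p *_) eq)
      (solve 2 (λ b Q → (con 1 :+ Q) :* (con 1 :+ b :* Q) := con 1 :+ (con 1 :+ (b :+ b :* Q)) :* Q) refl b (suc q))
    where open +-*-Solver

  lead-replicate-≢ : ∀ x n v → 0 < n → lead (flip x) (replicate n x ++ v) ≡ 0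
  lead-replicate-≢ A (suc n) v _ = refl
  lead-replicate-≢ B (suc n) v _ = refl

  lead-powerWord : ∀ x es → lead (flip x) (powerWord x es) ≡ 0
  lead-powerWord x []       = refl
  lead-powerWord x (e ∷ es) = lead-replicate-≢ x (p ^ e) _ (m^n>0 p e)

  F-[] : ∀ k → F k [] ≡ R 0 k
  F-[] zero    = refl
  F-[] (suc k) = refl

  F-powerB : ∀ k f fs → F (suc k) (powerWord B (f ∷ fs)) ≋ F k (powerWord A fs)
  F-powerB k f fs with p^-pred f
  ... | r , eq = ≋-trans (≋-reflexive (trans (cong (λ m → F (suc k) (replicate m B ++ powerWord A fs)) eq)
          (F-B k r (powerWord A fs) (lead-powerWord A fs))))
        (≋-+ (binomSum-p^≋ (runSeq k B (powerWord A fs)) f r eq) ≋-refl)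

  -- Modulo p the first factor is the whole A-run, or the whole A-run with the whole B-run, as in
  -- the recursion of `R`.
  F-block-∷ : ∀ k b f fs → F (suc k) (blockWord b (f ∷ fs)) ≋ F k (powerWord B (f ∷ fs)) + F k (powerWord A fs)
  F-block-∷ k b f fs with p^-pred f
  ... | r , eq = ≋-trans (≋-reflexive (cong (λ m → F (suc k)
      (replicate (suc (b * suc q)) A ++ (replicate m B ++ v))) eq))
        (≋-trans (recurrence≋ b (λ k → runSeq k A w) β (λ { zero → refl ; (suc _) → refl }) (λ _ → refl)
            (λ k j → F-AB k j r v (lead-powerWord A fs)) k)
          (≋-+ (≋-reflexive (cong (λ m → F k (replicate m B ++ v)) (sym eq)))
              (≋-+ (binomSum-p^≋ (runSeq k B v) f r eq) ≋-refl)))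
    where
    v = powerWord A fs
    w = replicate (suc r) B ++ v
    β : ℕ → ℕ
    β k = F k w + (binomSum (runSeq k B v) (suc r) + F k v)

  mutual
    F-powerA : ∀ k es → F k (powerWord A es) ≋ R (length es) k
    F-powerA k []       = ≋-reflexive (F-[] k)
    F-powerA k (e ∷ es) with p^≡1+ e
    ... | b , eq = ≋-trans (≋-reflexive (cong (λ m → F k (replicate m A ++ powerWord B es)) eq)) (F-block k b es)

    F-block : ∀ k b es → F k (blockWord b es) ≋ R (suc (length es)) k
    F-block zero          b es       = ≋-refl
    F-block (suc k)       b []       = ≋-trans (recurrence≋ b (λ k → runSeq k A []) (λ k → F k [])
        (λ { zero → refl ; (suc _) → refl }) (λ _ → refl) F-A k) (≋-reflexive (F-[] k))
    F-block (suc zero)    b (f ∷ fs) = ≋-trans (F-block-∷ 0 b f fs)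
        (≋-+ (≋-reflexive (F-0-power f fs)) (F-powerA 0 fs))
      where
      F-0-power : ∀ f fs → F 0 (powerWord B (f ∷ fs)) ≡ 0
      F-0-power f fs with p^-pred f
      ... | r , eq = cong (λ m → F 0 (replicate m B ++ powerWord A fs)) eq
    F-block (suc (suc k)) b (f ∷ fs) = ≋-trans (F-block-∷ (suc k) b f fs)
      (≋-+ (≋-trans (F-powerB k f fs) (F-powerA k fs)) (F-powerA (suc k) fs))

  -- The product (h choose c) · c ! equals h (h - 1) ... (h - c + 1); the factors are collected one
  -- by one.
  ∤-C : ∀ c h → c ≤ h → (∀ i → i < c → ¬ (p ∣ h ∸ i)) → ¬ (p ∣ h C c)
  ∤-C zero    h _   _ = p∤1
  ∤-C (suc c) h c<h p∤ d = ∤-* (∤-C c h (<⇒≤ c<h) λ i i<c → p∤ i (m<n⇒m<1+n i<c)) (p∤ c ≤-refl)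
    (subst (p ∣_) identity (∣m⇒∣m*n (suc c) d))
    where
    j = h ∸ suc c
    h≡ : c + suc j ≡ h
    h≡ = trans (+-suc c j) (m+[n∸m]≡n c<h)
    identity : (h C suc c) * suc c ≡ (h C c) * (h ∸ c)
    identity = trans (cong (λ m → (m C suc c) * suc c) (sym h≡)) (trans (C-suc c j)
      (cong₂ (λ m y → (m C c) * y) h≡ (sym (trans (cong (_∸ c) (sym h≡)) (m+n∸m≡n c (suc j))))))

  ∤-residue : ∀ r f → 0 < r → r < p → ¬ (p ∣ r + f * p)
  ∤-residue r@(suc _) f _ r<p d = <⇒≱ r<p (∣⇒≤ (∣m+n∣m⇒∣n (subst (p ∣_) (+-comm r (f * p)) d) (n∣m*n f)))

  odd-^ : ∀ {g} e → p ≡ suc (g + g) → ∃ λ f → p ^ e ≡ suc (f + f)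
  odd-^ zero _ = 0 , refl
  odd-^ {g} (suc e) eq with odd-^ {g} e eq
  ... | f , eq′ = g + f + (g + g) * f , trans (cong₂ _*_ eq eq′)
      (solve 2 (λ g f → (con 1 :+ (g :+ g)) :* (con 1 :+ (f :+ f)) := con 1 :+
          ((g :+ f :+ (g :+ g) :* f) :+ (g :+ f :+ (g :+ g) :* f))) refl g f)
    where open +-*-Solver

  -- For p = 2 g + 1 all base-p digits of (p ^ suc λ′ − 1) / 2 equal g, so adding ⌈ c /2⌉ ≤ g causes no carry.
  ∤-C-half : ∀ λ′ c → c ≤ q → ¬ (p ∣ ⌊ p ^ suc λ′ + c /2⌋ C c)
  ∤-C-half λ′ zero      _   = p∤1
  ∤-C-half λ′ c@(suc _) c≤q with even⊎odd p
  -- An even prime is 2, so q = 0, which leaves no positive c.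
  ... | inj₁ (g , eq) = contradiction (prime⇒irreducible pr
      (divides g (trans eq (trans (cong (λ z → g + z) (sym (+-identityʳ g))) (*-comm 2 g)))))
        [ (λ ()) , (λ 2≡p → contradiction (≤-trans c≤q
            (≤-reflexive (sym (suc-injective (suc-injective 2≡p))))) λ ()) ]′
  ... | inj₂ (g , p≡) with odd-^ {g} λ′ p≡
  ... | f , P≡ = subst (λ m → ¬ (p ∣ m C c)) (sym half) (∤-C c h c≤h p∤h)
    where
    open +-*-Solver
    c″ = ⌊ suc c /2⌋
    h = g + f * p + c″
    q+1≡ : suc q ≡ g + g
    q+1≡ = suc-injective p≡
    c″≤g : c″ ≤ g
    c″≤g = ≤-trans (⌊n/2⌋-mono (≤-trans (s≤s c≤q) (≤-reflexive q+1≡))) (≤-reflexive (sym (n≡⌊n+n/2⌋ g)))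
    power : p ^ suc λ′ ≡ suc ((g + f * p) + (g + f * p))
    power = trans (cong (p *_) P≡) (trans (solve 2
        (λ p f → p :* (con 1 :+ (f :+ f)) := p :+ (f :* p :+ f :* p)) refl p f)
      (trans (cong (_+ (f * p + f * p)) p≡) (solve 2
          (λ g y → con 1 :+ (g :+ g) :+ (y :+ y) := con 1 :+ ((g :+ y) :+ (g :+ y))) refl g (f * p))))
    half : ⌊ p ^ suc λ′ + c /2⌋ ≡ h
    half = trans (cong (λ m → ⌊ m + c /2⌋) power)
        (trans (cong ⌊_/2⌋ (sym (+-suc ((g + f * p) + (g + f * p)) c))) (⌊n+n+m/2⌋ (g + f * p) (suc c)))
    c≤g+c″ : c ≤ g + c″
    c≤g+c″ = ≤-trans (≤-reflexive (sym (⌊n/2⌋+⌈n/2⌉≡n c)))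
      (+-monoˡ-≤ c″ (≤-trans (⌊n/2⌋-mono (≤-trans (m≤n⇒m≤1+n c≤q) (≤-reflexive q+1≡)))
          (≤-reflexive (sym (n≡⌊n+n/2⌋ g)))))
    h≡ : h ≡ g + c″ + f * p
    h≡ = solve 3 (λ g y c → g :+ y :+ c := g :+ c :+ y) refl g (f * p) c″
    c≤h : c ≤ h
    c≤h = ≤-trans c≤g+c″ (≤-trans (m≤m+n (g + c″) (f * p)) (≤-reflexive (sym h≡)))
    -- Modulo p, h - i is g + c″ - i, which lies strictly between 0 and p because i < c ≤ g + c″ ≤ 2
    -- g.
    p∤h : ∀ i → i < c → ¬ (p ∣ h ∸ i)
    p∤h i i<c = subst (λ m → ¬ (p ∣ m)) (sym (trans (cong (_∸ i) h≡) (+-∸-comm (f * p) (<⇒≤ i<g+c″))))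
      (∤-residue (g + c″ ∸ i) f (m<n⇒0<n∸m i<g+c″)
          (≤-<-trans (m∸n≤m (g + c″) i) (≤-trans (s≤s (+-monoʳ-≤ g c″≤g)) (≤-reflexive (sym p≡)))))
      where
      i<g+c″ : i < g + c″
      i<g+c″ = ≤-trans i<c c≤g+c″

-- Block words attain the full denominator at p

module Lower (q : ℕ) (pr : Prime (2 + q)) where
  open Blocks q pr public

  length-powerWord : ∀ x e es → length (powerWord x (e ∷ es)) ≡ p ^ e + length (powerWord (flip x) es)
  length-powerWord x e es = trans (length-++ (replicate (p ^ e) x)) (cong (_+ _) (length-replicate (p ^ e)))

  length-powerWord-flip : ∀ x y es → length (powerWord x es) ≡ length (powerWord y es)
  length-powerWord-flip x y []       = refl
  length-powerWord-flip x y (e ∷ es) = trans (length-powerWord x e es)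
    (trans (cong (λ z → p ^ e + z) (length-powerWord-flip (flip x) (flip y) es)) (sym (length-powerWord y e es)))

  -- Legendre's formula for every run; a run of length p ^ e has digit sum 1, so the digit sums add
  -- up to the number of runs.
  runFactorial-powerWord : ∀ x es → ∃₂ λ v u → ¬ (p ∣ u) × runFactorial (powerWord x es) ≡ p ^ v * u
    × length (powerWord x es) ≡ length es + suc q * v
  runFactorial-powerWord x [] = 0 , 1 , p∤1 , refl , sym (*-zeroʳ (suc q))
  runFactorial-powerWord x (e ∷ es) = combine (legendre (p ^ e)) (runFactorial-powerWord (flip x) es)
    where
    open +-*-Solver
    combine : (∃₂ λ v u → ¬ (p ∣ u) × (p ^ e) ! ≡ p ^ v * u × p ^ e ≡ s p (p ^ e) + suc q * v) →
      (∃₂ λ v u → ¬ (p ∣ u) × runFactorial (powerWord (flip x) es) ≡ p ^ v * u × length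
          (powerWord (flip x) es) ≡ length es + suc q * v) →
      ∃₂ λ v u → ¬ (p ∣ u) × runFactorial (powerWord x (e ∷ es)) ≡ p ^ v * u × length
          (powerWord x (e ∷ es)) ≡ suc (length es) + suc q * v
    combine (v , u , p∤u , eq , size) (v′ , u′ , p∤u′ , eq′ , size′) = v + v′ , u * u′ , ∤-* p∤u p∤u′
      , trans (runFactorial-run x (p ^ e) (powerWord (flip x) es) lead≡0)
          (trans (cong₂ _*_ eq eq′) (trans (solve 4 (λ a u b w → a :* u :* (b :* w) := a :* b :* (u :* w)) refl
              (p ^ v) u (p ^ v′) u′)
            (cong (_* (u * u′)) (sym (^-distribˡ-+-* p v v′)))))
      , trans (length-powerWord x e es) (trans (cong₂ _+_ (trans size (cong (_+ suc q * v) (s-pow e))) size′)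
          (solve 4 (λ L Q v w → con 1 :+ Q :* v :+ (L :+ Q :* w) := con 1 :+ L :+ Q :* (v :+ w)) refl
              (length es) (suc q) v v′))
      where
      lead≡0 : lead x (powerWord (flip x) es) ≡ 0
      lead≡0 = subst (λ y → lead y (powerWord (flip x) es) ≡ 0) (flip-flip x) (lead-powerWord (flip x) es)
        where
        flip-flip : ∀ x → flip (flip x) ≡ x
        flip-flip A = refl
        flip-flip B = refl

  runFactorial-blockWord : ∀ b es → ∃₂ λ v u → ¬ (p ∣ u) × runFactorial (blockWord b es) ≡ p ^ v * u
    × length (blockWord b es) ≡ s p (suc (b * suc q)) + length es + suc q * v
  runFactorial-blockWord b es = combine (legendre Q) (runFactorial-powerWord B es)
    where
    open +-*-Solver
    Q = suc (b * suc q)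
    combine : (∃₂ λ v u → ¬ (p ∣ u) × Q ! ≡ p ^ v * u × Q ≡ s p Q + suc q * v) →
      (∃₂ λ v u → ¬ (p ∣ u) × runFactorial (powerWord B es) ≡ p ^ v * u × length
          (powerWord B es) ≡ length es + suc q * v) →
      ∃₂ λ v u → ¬ (p ∣ u) × runFactorial (blockWord b es) ≡ p ^ v * u × length
          (blockWord b es) ≡ s p Q + length es + suc q * v
    combine (v , u , p∤u , eq , size) (v′ , u′ , p∤u′ , eq′ , size′) = v + v′ , u * u′ , ∤-* p∤u p∤u′
      , trans (runFactorial-run A Q (powerWord B es) (lead-powerWord B es))
          (trans (cong₂ _*_ eq eq′) (trans (solve 4 (λ a u b w → a :* u :* (b :* w) := a :* b :* (u :* w)) refl
              (p ^ v) u (p ^ v′) u′)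
            (cong (_* (u * u′)) (sym (^-distribˡ-+-* p v v′)))))
      , trans (trans (length-++ (replicate Q A)) (cong (_+ length (powerWord B es)) (length-replicate Q)))
          (trans (cong₂ _+_ size size′)
            (solve 5 (λ a L Q v w → a :+ Q :* v :+ (L :+ Q :* w) := a :+ L :+ Q :* (v :+ w)) refl (s p Q)
                (length es) (suc q) v v′))

  -- ε counts the carries in the addition of the block lengths.
  module _ {n : ℕ} (0<n : 0 < n) (b ε c λ′ : ℕ) (es : List ℕ)
    (length≡ : length (blockWord b es) ≡ n)
    (carries : s p (suc (b * suc q)) + length es ≡ s p n + suc q * ε)
    (blocks  : suc (length es) ≡ p ^ suc λ′ + c)
    (c≤q     : c ≤ q)
    (λ≡      : suc λ′ ≡ l n p + ε)
    -- Serves the k divisible by p ^ (2 + λ′): their coefficients must supply at least 2 + ε factors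
    -- p.
    (bound   : s p n + suc q * suc ε < p ^ (2 + λ′))
    where

    private
      w = blockWord b es
      Λ = suc λ′
      lₙ = l n p
      μ = proj₁ (d-split 0<n)
      d≡ : d n ≡ p ^ lₙ * μ
      d≡ = proj₁ (proj₂ (d-split 0<n))
      p∤μ : ¬ (p ∣ μ)
      p∤μ = proj₂ (proj₂ (d-split 0<n))

    -- Legendre's formula on both sides: the digit sums differ by (p - 1) ε, hence the valuations by
    -- ε.
    n!-runFactorial : ∃₂ λ u u′ → ¬ (p ∣ u) × ¬ (p ∣ u′) × u * n ! ≡ p ^ ε * u′ * runFactorial w
    n!-runFactorial = combine (legendre n) (runFactorial-blockWord b es)
      where
      open +-*-Solver
      combine : (∃₂ λ v u → ¬ (p ∣ u) × n ! ≡ p ^ v * u × n ≡ s p n + suc q * v) →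
        (∃₂ λ v u → ¬ (p ∣ u) × runFactorial w ≡ p ^ v * u × length w ≡ s p
            (suc (b * suc q)) + length es + suc q * v) →
        ∃₂ λ u u′ → ¬ (p ∣ u) × ¬ (p ∣ u′) × u * n ! ≡ p ^ ε * u′ * runFactorial w
      combine (v , u , p∤u , eq , size) (v′ , u′ , p∤u′ , eq′ , size′) = u′ , u , p∤u′ , p∤u
        , trans (cong (u′ *_) (trans eq (cong (_* u) (trans (cong (p ^_) v≡) (^-distribˡ-+-* p ε v′)))))
            (trans (solve 4 (λ a x y b → a :* (x :* y :* b) := x :* b :* (y :* a)) refl u′ (p ^ ε) (p ^ v′) u)
                (cong (p ^ ε * u *_) (sym eq′)))
        where
        v≡ : v ≡ ε + v′
        v≡ = *-cancelˡ-≡ v (ε + v′) (suc q) (+-cancelˡ-≡ (s p n) _ _ (trans (sym size) (trans (sym length≡)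
          (trans size′ (trans (cong (_+ suc q * v′) carries)
              (solve 4 (λ s Q e v → s :+ Q :* e :+ Q :* v := s :+ Q :* (e :+ v)) refl (s p n) (suc q) ε v′))))))

    relation : ∀ k → ∃₂ λ u u′ → ∃ λ G → ¬ (p ∣ u) × ¬ (p ∣ u′) × fromℕ (n !) ℚ.* (X ^S k) w ≡ fromℕ G
        × u * G ≡ p ^ ε * u′ * F k w
    relation k = combine n!-runFactorial (X^-divisibility k w)
      where
      open ≡-Reasoning
      combine : (∃₂ λ u u′ → ¬ (p ∣ u) × ¬ (p ∣ u′) × u * n ! ≡ p ^ ε * u′ * runFactorial w) →
        (∃ λ g → fromℕ (length w !) ℚ.* (X ^S k) w ≡ fromℕ g ×
            (∀ e → s p (length w) + suc q * e < k + suc q → p ^ e ∣ g)) →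
        ∃₂ λ u u′ → ∃ λ G → ¬ (p ∣ u) × ¬ (p ∣ u′) × fromℕ (n !) ℚ.* (X ^S k) w ≡ fromℕ G
            × u * G ≡ p ^ ε * u′ * F k w
      combine (u , u′ , p∤u , p∤u′ , eq) (G , eqG , _) = u , u′ , G , p∤u , p∤u′ , eqG′ , fromℕ-injective (begin
        fromℕ (u * G)                                                ≡⟨ trans (fromℕ-* u G)
            (cong (fromℕ u ℚ.*_) (sym eqG′)) ⟩
        fromℕ u ℚ.* (fromℕ (n !) ℚ.* (X ^S k) w)                     ≡⟨ sym
            (ℚ.*-assoc (fromℕ u) (fromℕ (n !)) ((X ^S k) w)) ⟩
        fromℕ u ℚ.* fromℕ (n !) ℚ.* (X ^S k) w                       ≡⟨ cong (ℚ._* (X ^S k) w)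
            (trans (sym (fromℕ-* u (n !))) (trans (cong fromℕ eq) (fromℕ-* (p ^ ε * u′) (runFactorial w)))) ⟩
        fromℕ (p ^ ε * u′) ℚ.* fromℕ (runFactorial w) ℚ.* (X ^S k) w ≡⟨ ℚ.*-assoc (fromℕ (p ^ ε * u′))
            (fromℕ (runFactorial w)) ((X ^S k) w) ⟩
        fromℕ (p ^ ε * u′) ℚ.* (fromℕ (runFactorial w) ℚ.* (X ^S k) w) ≡⟨ cong (fromℕ (p ^ ε * u′) ℚ.*_)
            (runFactorial*X^ k w) ⟩
        fromℕ (p ^ ε * u′) ℚ.* fromℕ (F k w)                         ≡⟨ sym (fromℕ-* (p ^ ε * u′) (F k w)) ⟩
        fromℕ (p ^ ε * u′ * F k w)                                   ∎)
        where
        eqG′ : fromℕ (n !) ℚ.* (X ^S k) w ≡ fromℕ G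
        eqG′ = trans (cong (λ m → fromℕ (m !) ℚ.* (X ^S k) w) (sym length≡)) eqG

    -- The factor p ^ lₙ of `d n` and the surplus p ^ ε of n ! over the run factorials combine to p
    -- ^ Λ, the denominator that the main term consumes.
    d-relation : ∀ k′ u u′ G F → u * G ≡ p ^ ε * u′ * F → k′ * u * (d n * G) ≡ p ^ Λ * k′ * (μ * u′ * F)
    d-relation k′ u u′ G F eq = begin
      k′ * u * (d n * G)                     ≡⟨ cong (λ x → k′ * u * (x * G)) d≡ ⟩
      k′ * u * (p ^ lₙ * μ * G)              ≡⟨ solve 5
          (λ k u P m G → k :* u :* (P :* m :* G) := k :* P :* m :* (u :* G)) refl k′ u (p ^ lₙ) μ G ⟩
      k′ * p ^ lₙ * μ * (u * G)              ≡⟨ cong (k′ * p ^ lₙ * μ *_) eq ⟩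
      k′ * p ^ lₙ * μ * (p ^ ε * u′ * F)     ≡⟨ solve 6
          (λ k P m E u F → k :* P :* m :* (E :* u :* F) := P :* E :* k :* (m :* u :* F)) refl k′ (p ^ lₙ) μ
          (p ^ ε) u′ F ⟩
      p ^ lₙ * p ^ ε * k′ * (μ * u′ * F)     ≡⟨ cong (λ x → x * k′ * (μ * u′ * F))
          (trans (sym (^-distribˡ-+-* p lₙ ε)) (cong (p ^_) (sym λ≡))) ⟩
      p ^ Λ * k′ * (μ * u′ * F)              ∎
      where
      open ≡-Reasoning
      open +-*-Solver

    -- Hence p ^ Λ is its own only positive multiple up to the number of blocks.
    m<2p^Λ : suc (length es) < p ^ Λ * 2
    m<2p^Λ = begin-strict
      suc (length es)    ≡⟨ blocks ⟩
      p ^ Λ + c          <⟨ +-monoʳ-< (p ^ Λ) (≤-trans (s≤s c≤q)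
          (≤-trans (n≤1+n (suc q)) (m≤m*n p (p ^ λ′) {{m^n≢0 p λ′}}))) ⟩
      p ^ Λ + p ^ Λ      ≡⟨ solve 1 (λ x → x :+ x := x :* con 2) refl (p ^ Λ) ⟩
      p ^ Λ * 2          ∎
      where
      open ≤-Reasoning
      open +-*-Solver

    p∣F : ∀ k → suc (length es) < k → p ∣ F k w
    p∣F k m<k = ≋0⇒∣ (≋-trans (F-block k b es) (≋-reflexive (R-0 (suc (length es)) k m<k)))

    p∤F : ¬ (p ∣ F (p ^ Λ) w)
    p∤F div = ∤-C-half λ′ c c≤q (≋0⇒∣ (≋-trans (≋-reflexive (sym (R-closed (p ^ Λ) c)))
      (≋-trans (≋-reflexive (cong (λ m → R m (p ^ Λ)) (sym blocks)))
          (≋-trans (≋-sym (F-block (p ^ Λ) b es)) (∣⇒≋0 div)))))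

    N = n ! * d n

    main-term : ∀ k → suc k ≡ p ^ Λ → Unitₚ (fromℕ N ℚ.* H-term k w)
    main-term k k≡ = go (relation (suc k))
      where
      go : (∃₂ λ u u′ → ∃ λ G → ¬ (p ∣ u) × ¬ (p ∣ u′) × fromℕ (n !) ℚ.* (X ^S suc k) w ≡ fromℕ G
          × u * G ≡ p ^ ε * u′ * F (suc k) w) →
        Unitₚ (fromℕ N ℚ.* H-term k w)
      go (u , u′ , G , p∤u , p∤u′ , eqG , eq) = term-Unitₚ (n !) (d n) k w (1 * u) (μ * u′ * F (suc k) w)
        (subst (λ x → ¬ (p ∣ x)) (sym (*-identityˡ u)) p∤u)
        (∤-* (∤-* p∤μ p∤u′) (subst (λ x → ¬ (p ∣ F x w)) (sym k≡) p∤F)) eqG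
        (trans (d-relation 1 u u′ G (F (suc k) w) eq)
            (cong (_* (μ * u′ * F (suc k) w)) (trans (*-identityʳ (p ^ Λ)) (sym k≡))))

    other-term : ∀ k → suc k ≢ p ^ Λ → p ∣ₚ (fromℕ N ℚ.* H-term k w)
    other-term k k≢ = go (factor (suc k) (s≤s z≤n)) (relation (suc k))
      where
      open +-*-Solver
      go : (∃₂ λ t k′ → ¬ (p ∣ k′) × suc k ≡ p ^ t * k′) →
        (∃₂ λ u u′ → ∃ λ G → ¬ (p ∣ u) × ¬ (p ∣ u′) × fromℕ (n !) ℚ.* (X ^S suc k) w ≡ fromℕ G
            × u * G ≡ p ^ ε * u′ * F (suc k) w) →
        p ∣ₚ (fromℕ N ℚ.* H-term k w)
      go (t , k′ , p∤k′ , k≡) (u , u′ , G , p∤u , p∤u′ , eqG , eq) with <-cmp t Λ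
      -- Here k is so large that the general bound alone leaves a factor p.
      ... | tri> _ _ t>Λ = high-term 0<n w length≡ k t k′ k≡ p∤k′ p 1 (suc (suc ε + e))
          (sym (*-identityʳ p)) exps bound′
        where
        e = t ∸ suc Λ
        t≡ : suc Λ + e ≡ t
        t≡ = m+[n∸m]≡n t>Λ
        exps : t + 1 ≡ lₙ + suc (suc ε + e)
        exps = trans (cong (_+ 1) (trans (sym t≡) (cong (λ x → suc x + e) λ≡)))
          (solve 3 (λ L E e → con 1 :+ (L :+ E) :+ e :+ con 1 := L :+ (con 1 :+ (con 1 :+ E :+ e))) refl lₙ ε e)
        bound′ : s p n + suc q * suc (suc ε + e) < p ^ t + suc q
        bound′ = subst₂ _<_
          (solve 4 (λ s Q E e → s :+ Q :* (con 1 :+ E) :+ Q :* e :+ Q := s :+ Q :*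
              (con 1 :+ (con 1 :+ E :+ e))) refl (s p n) (suc q) ε e)
          (cong (_+ suc q) (trans (sym (^-distribˡ-+-* p (suc Λ) e)) (cong (p ^_) t≡)))
          (+-monoˡ-< (suc q) (growth {Q = suc q} e (m^n>0 p (suc Λ)) bound))
      -- The denominator takes fewer than the Λ factors p available.
      ... | tri< t<Λ _ _ = term-∣ₚ p (n !) (d n) k w (k′ * u) (p ^ (Λ ∸ suc t) * (μ * u′ * F (suc k) w))
          (∤-* p∤k′ p∤u) eqG
          (trans (d-relation k′ u u′ G (F (suc k) w) eq)
            (trans (cong (λ x → x * k′ * (μ * u′ * F (suc k) w))
                (trans (cong (p ^_) (sym (m+[n∸m]≡n t<Λ))) (^-distribˡ-+-* p (suc t) (Λ ∸ suc t))))
              (trans (solve 5 (λ p P R k z → p :* P :* R :* k :* z := P :* k :* (p :* (R :* z))) refl p (p ^ t)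
                  (p ^ (Λ ∸ suc t)) k′ (μ * u′ * F (suc k) w))
                (cong (_* (p * (p ^ (Λ ∸ suc t) * (μ * u′ * F (suc k) w)))) (sym k≡)))))
      -- A proper multiple of p ^ Λ exceeds the number of blocks, so `F` supplies the missing p.
      ... | tri≈ _ refl _ = finish (p∣F (suc k) (≤-trans m<2p^Λ
          (≤-trans (*-monoʳ-≤ (p ^ Λ) 2≤k′) (≤-reflexive (sym k≡)))))
        where
        2≤k′ : 2 ≤ k′
        2≤k′ = atLeast2 k′ refl
          where
          atLeast2 : ∀ j → k′ ≡ j → 2 ≤ j
          atLeast2 zero          k′≡ = contradiction (subst (p ∣_) (sym k′≡) (p ∣0)) p∤k′
          atLeast2 (suc zero)    k′≡ = contradiction
              (trans k≡ (trans (cong (p ^ Λ *_) k′≡) (*-identityʳ (p ^ Λ)))) k≢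
          atLeast2 (suc (suc j)) _   = s≤s (s≤s z≤n)
        finish : p ∣ F (suc k) w → p ∣ₚ (fromℕ N ℚ.* H-term k w)
        finish (divides F′ F≡) = term-∣ₚ p (n !) (d n) k w (k′ * u) (μ * u′ * F′) (∤-* p∤k′ p∤u) eqG
          (trans (d-relation k′ u u′ G (F (suc k) w) eq) (cong₂ _*_ (sym k≡)
            (trans (cong (μ * u′ *_) F≡) (solve 3 (λ m F p → m :* (F :* p) := p :* (m :* F)) refl (μ * u′) F′ p))))

    blockWord-unit : Unitₚ (fromℕ N ℚ.* H w)
    blockWord-unit = go (p^-pred Λ)
      where
      m≤length : suc (length es) ≤ length w
      m≤length = shorter (runFactorial-blockWord b es)
        where
        shorter : (∃₂ λ v u → ¬ (p ∣ u) × runFactorial w ≡ p ^ v * u × length w ≡ s p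
            (suc (b * suc q)) + length es + suc q * v) → suc (length es) ≤ length w
        shorter (v , _ , _ , _ , size) = ≤-trans (+-monoˡ-≤ (length es) (s-pos (suc (b * suc q)) (s≤s z≤n)))
          (≤-trans (m≤m+n _ (suc q * v)) (≤-reflexive (sym size)))
      go : (∃ λ r → p ^ Λ ≡ suc r) → Unitₚ (fromℕ N ℚ.* H w)
      go (r , eq) = H-Unitₚ N w r (≤-trans (≤-reflexive (sym eq))
          (≤-trans (m≤m+n (p ^ Λ) c) (≤-trans (≤-reflexive (sym blocks)) m≤length)))
        (main-term r (sym eq)) (λ k _ k≢r → other-term k λ k≡ → k≢r (suc-injective (trans k≡ eq)))

-- Choice of the block lengths

module Construction (q : ℕ) (pr : Prime (2 + q)) where
  open Lower q pr public

  powerSum : List ℕ → ℕ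
  powerSum []       = 0
  powerSum (e ∷ es) = p ^ e + powerSum es

  length-powerSum : ∀ x es → length (powerWord x es) ≡ powerSum es
  length-powerSum x []       = refl
  length-powerSum x (e ∷ es) = trans (length-powerWord x e es)
      (cong (λ m → p ^ e + m) (length-powerSum (flip x) es))

  length-blockWord : ∀ b es → length (blockWord b es) ≡ suc (b * suc q) + powerSum es
  length-blockWord b es = trans (length-++ (replicate (suc (b * suc q)) A))
    (cong₂ _+_ (length-replicate (suc (b * suc q))) (length-powerSum B es))

  -- Digit units are removed one at a time. The digit sum drops by exactly j, so putting them back
  -- causes no carry.
  split-powers : ∀ j n → j ≤ s p n → ∃₂ λ es m → length es ≡ j × n ≡ m + powerSum es × s p n ≡ j + s p m
  split-powers zero    n _   = [] , n , refl , sym (+-identityʳ n) , refl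
  split-powers (suc j) zero ()
  split-powers (suc j) n@(suc _) j<s = go (split-power n (s≤s z≤n))
    where
    open +-*-Solver
    go : (∃₂ λ a m → n ≡ p ^ a + m × s p n ≡ suc (s p m) × (p ≤ n → 0 < a)) →
      ∃₂ λ es m → length es ≡ suc j × n ≡ m + powerSum es × s p n ≡ suc j + s p m
    go (a , m , n≡ , s≡ , _) with split-powers j m (≤-pred (≤-trans j<s (≤-reflexive s≡)))
    ... | es , m′ , len , m≡ , s≡′ = a ∷ es , m′ , cong suc len
        , trans n≡ (trans (cong (λ x → p ^ a + x) m≡)
            (solve 3 (λ x y z → x :+ (y :+ z) := y :+ (x :+ z)) refl (p ^ a) m′ (powerSum es)))
        , trans s≡ (cong suc s≡′)

  s≡0⇒≡0 : ∀ n → s p n ≡ 0 → n ≡ 0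
  s≡0⇒≡0 zero    _  = refl
  s≡0⇒≡0 n@(suc _) eq = contradiction (subst (0 <_) eq (s-pos n (s≤s z≤n))) λ ()

  powerSum-replicate : ∀ m a es → powerSum (replicate m a ++ es) ≡ m * p ^ a + powerSum es
  powerSum-replicate zero    a es = refl
  powerSum-replicate (suc m) a es = trans (cong (λ x → p ^ a + x) (powerSum-replicate m a es))
      (sym (+-assoc (p ^ a) (m * p ^ a) (powerSum es)))

  module _ {n : ℕ} (0<n : 0 < n) where

    private
      lₙ = l n p
      S = s p n

    UnitWord : Set
    UnitWord = ∃ λ w → length w ≡ n × Unitₚ (fromℕ (n ! * d n) ℚ.* H w)

    -- With c the residue of S - p ^ lₙ modulo p - 1, the p ^ lₙ + c - 1 later blocks are digit
    -- units of n. The rest has digit sum 1 modulo p - 1, hence is itself 1 modulo p - 1, and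
    -- becomes the first block.
    no-carry : S + suc q < p ^ suc lₙ → UnitWord
    no-carry S< = go lₙ refl (p^-pred lₙ)
      where
      open +-*-Solver
      go : ∀ t → lₙ ≡ t → (∃ λ x → p ^ lₙ ≡ suc x) → UnitWord
      -- S ≥ 1 rules out lₙ = 0, so the exponent of the main term is positive.
      go zero l≡0 _ = contradiction (≤-trans S< (≤-trans
          (≤-reflexive (trans (cong (λ t → p ^ suc t) l≡0) (*-identityʳ p))) (+-monoˡ-≤ (suc q) (s-pos n 0<n))))
          1+n≰n
      go (suc λ′) l≡ (x , P≡) = build (split-powers (x + c) n j≤S)
        where
        y = S ∸ p ^ lₙ
        c = y % suc q
        b′ = y / suc q
        S≡ : S ≡ suc (x + c) + b′ * suc q
        S≡ = trans (sym (m+[n∸m]≡n (p^l≤s 0<n))) (trans (cong₂ _+_ P≡ (m≡m%n+[m/n]*n y (suc q)))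
          (solve 3 (λ x c z → con 1 :+ x :+ (c :+ z) := con 1 :+ (x :+ c) :+ z) refl x c (b′ * suc q)))
        j≤S : x + c ≤ S
        j≤S = ≤-trans (n≤1+n (x + c)) (≤-trans (m≤m+n (suc (x + c)) (b′ * suc q)) (≤-reflexive (sym S≡)))
        build : (∃₂ λ es m → length es ≡ x + c × n ≡ m + powerSum es × S ≡ x + c + s p m) → UnitWord
        build (es , m , len , n≡ , S≡′) = finish (legendre m)
          where
          sm≡ : s p m ≡ suc (b′ * suc q)
          sm≡ = +-cancelˡ-≡ (x + c) _ _ (trans (sym S≡′) (trans S≡ (sym (+-suc (x + c) (b′ * suc q)))))
          finish : (∃₂ λ v u → ¬ (p ∣ u) × m ! ≡ p ^ v * u × m ≡ s p m + suc q * v) → UnitWord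
          finish (v , _ , _ , _ , m≡) = blockWord (b′ + v) es , length≡ ,
            blockWord-unit 0<n (b′ + v) 0 c λ′ es length≡
              (trans (cong₂ (λ a b → s p a + b) (sym m≡′) len)
                  (trans (+-comm (s p m) (x + c)) (trans (sym S≡′)
                  (sym (trans (cong (λ z → S + z) (*-zeroʳ (suc q))) (+-identityʳ S))))))
              (trans (cong suc len) (cong (λ z → z + c) (trans (sym P≡) (cong (p ^_) l≡))))
              (≤-pred (m%n<n y (suc q)))
              (trans (sym l≡) (sym (+-identityʳ lₙ)))
              (subst₂ (λ a t → S + a < p ^ suc t) (sym (*-identityʳ (suc q))) l≡ S<)
            where
            m≡′ : m ≡ suc ((b′ + v) * suc q)
            m≡′ = trans m≡ (trans (cong (λ z → z + suc q * v) sm≡)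
                (solve 3 (λ b v Q → con 1 :+ b :* Q :+ Q :* v := con 1 :+ (b :+ v) :* Q) refl b′ v (suc q)))
            length≡ : length (blockWord (b′ + v) es) ≡ n
            length≡ = trans (length-blockWord (b′ + v) es) (trans (cong (λ z → z + powerSum es) (sym m≡′)) (sym n≡))

    -- The leading p ^ suc a is broken into p blocks of length p ^ a, the first of which opens the
    -- word. All other digit units stay, so there are S + p - 1 blocks and their sum has one carry.
    one-carry : p ≤ n → p ^ suc lₙ ≤ S + suc q → UnitWord
    one-carry p≤n S≥ = go (split-power n 0<n)
      where
      open +-*-Solver
      go : (∃₂ λ a m → n ≡ p ^ a + m × S ≡ suc (s p m) × (p ≤ n → 0 < a)) → UnitWord
      go (zero , _ , _ , _ , pos) = contradiction (pos p≤n) λ ()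
      go (suc a , m , n≡ , S≡ , _) = build (split-powers (s p m) m ≤-refl) (p^≡1+ a)
        where
        c = S + suc q ∸ p ^ suc lₙ
        build : (∃₂ λ es m′ → length es ≡ s p m × m ≡ m′ + powerSum es × s p m ≡ s p m + s p m′) →
            (∃ λ b → p ^ a ≡ suc (b * suc q)) →
          UnitWord
        build (es , m′ , len , m≡ , s≡) (b , pa≡) = blockWord b fs , length≡ ,
          blockWord-unit 0<n b 1 c lₙ fs length≡
            (trans (cong₂ (λ a b → s p a + b) (sym pa≡) len′) (trans (cong (λ z → z + (suc q + s p m)) (s-pow a))
              (trans (solve 2 (λ Q t → con 1 :+ (Q :+ t) := con 1 :+ t :+ Q :* con 1) refl (suc q) (s p m))
                  (cong (λ z → z + suc q * 1) (sym S≡)))))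
            (trans (cong suc len′) (trans (trans (solve 2 (λ Q t → con 1 :+ (Q :+ t) := con 1 :+ t :+ Q) refl
                (suc q) (s p m)) (cong (λ z → z + suc q) (sym S≡))) (sym (m+[n∸m]≡n S≥))))
            -- From S < p ^ suc lₙ the excess c of S + p - 1 is at most p - 2.
            (≤-trans (∸-monoˡ-≤ (p ^ suc lₙ) (≤-trans (≤-reflexive (+-suc S q)) (+-monoˡ-≤ q (s<p^1+l 0<n))))
                (≤-reflexive (m+n∸m≡n (p ^ suc lₙ) q)))
            (+-comm 1 lₙ)
            bound
          where
          fs = replicate (suc q) a ++ es
          m′≡0 : m′ ≡ 0
          m′≡0 = s≡0⇒≡0 m′ (sym (+-cancelˡ-≡ (s p m) 0 (s p m′) (trans (+-identityʳ (s p m)) s≡)))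
          len′ : length fs ≡ suc q + s p m
          len′ = trans (length-++ (replicate (suc q) a)) (cong₂ _+_ (length-replicate (suc q)) len)
          length≡ : length (blockWord b fs) ≡ n
          length≡ = trans (length-blockWord b fs) (trans (cong₂ _+_ (sym pa≡) (powerSum-replicate (suc q) a es))
            (trans (sym (+-assoc (p ^ a) (suc q * p ^ a) (powerSum es)))
                (trans (cong (λ z → p * p ^ a + z) (sym (trans m≡ (cong (λ z → z + powerSum es) m′≡0)))) (sym n≡))))
          P = p ^ suc lₙ
          bound : S + suc q * 2 < p ^ (2 + lₙ)
          bound = begin-strict
            S + suc q * 2    <⟨ +-monoˡ-< (suc q * 2) (s<p^1+l 0<n) ⟩
            P + suc q * 2    ≤⟨ +-monoʳ-≤ P (*-monoʳ-≤ (suc q)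
                (≤-trans (s≤s (s≤s z≤n)) (m≤m*n p (p ^ lₙ) {{m^n≢0 p lₙ}}))) ⟩
            P + suc q * P    ∎
            where open ≤-Reasoning

    unit-word : p ≤ n → UnitWord
    unit-word p≤n with S + suc q <? p ^ suc lₙ
    ... | yes S< = no-carry S<
    ... | no S≮ = one-carry p≤n (≮⇒≥ S≮)

  -- For primes above n nothing has to be attained: `n ! * d n` itself can be the multiplier in
  -- `∣-local-global`.
  ∤-small : ∀ {n} → 0 < n → n < p → ¬ (p ∣ n ! * d n)
  ∤-small {n} 0<n n<p = ∤-* (p∤! n n<p) (subst (λ x → ¬ (p ∣ x)) (sym d≡) (proj₂ (proj₂ (d-split 0<n))))
    where
    p∤! : ∀ m → m < p → ¬ (p ∣ m !)
    p∤! zero    _   = p∤1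
    p∤! (suc m) m<p = ∤-* (λ div → <⇒≱ m<p (∣⇒≤ div)) (p∤! m (<⇒≤ m<p))
    d≡ : d n ≡ proj₁ (d-split 0<n)
    d≡ = trans (proj₁ (proj₂ (d-split 0<n))) (trans
        (cong (λ t → p ^ t * proj₁ (d-split 0<n)) (s<p⇒l≡0 0<n (subst (_< p) (sym (s-small n n<p)) n<p)))
        (*-identityˡ _))

-- Assembling the primes

∈-wordsOfLength : ∀ w → w ∈ wordsOfLength (length w)
∈-wordsOfLength []      = here refl
∈-wordsOfLength (A ∷ w) = ∈-concatMap⁺ _ (Any.map (λ { refl → here refl }) (∈-wordsOfLength w))
∈-wordsOfLength (B ∷ w) = ∈-concatMap⁺ _ (Any.map (λ { refl → there (here refl) }) (∈-wordsOfLength w))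

wordsOfLength-length : ∀ n → All (λ w → length w ≡ n) (wordsOfLength n)
wordsOfLength-length zero    = refl ∷ []
wordsOfLength-length (suc n) = All.concat⁺ (All.map⁺
    (All.map (λ eq → cong suc eq ∷ cong suc eq ∷ []) (wordsOfLength-length n)))

lcmList-least : ∀ {m ns} → All (_∣ m) ns → lcmList ns ∣ m
lcmList-least []          = 1∣ _
lcmList-least (n∣m ∷ ns∣m) = lcm-least n∣m (lcmList-least ns∣m)

∈⇒∣lcmList : ∀ {n ns} → n ∈ ns → n ∣ lcmList ns
∈⇒∣lcmList {ns = n ∷ ns} (here refl) = m∣lcm[m,n] n (lcmList ns)
∈⇒∣lcmList {ns = n ∷ ns} (there n∈)  = ∣-trans (∈⇒∣lcmList n∈) (n∣lcm[m,n] n (lcmList ns))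

clear-denom : ∀ N r u a → fromℕ u ℚ.* (fromℕ N ℚ.* r) ≡ fromℤ a → u * N * ℤ.∣ ℚ.↥ r ∣ ≡ ℤ.∣ a ∣ * denom r
clear-denom N r u a eq = trans (sym (ℤ.abs-* (+ (u * N)) (ℚ.↥ r)))
  (trans (cong ℤ.∣_∣ (clear-denominator r a (u * N)
      (trans (cong (ℚ._* r) (fromℕ-* u N)) (trans (ℚ.*-assoc (fromℕ u) (fromℕ N) r) eq))))
    (ℤ.abs-* a (ℚ.↧ r)))

denom-coprime : ∀ r → Coprime.Coprime (denom r) ℤ.∣ ℚ.↥ r ∣
denom-coprime (ℚ.mkℚ ν δ-1 c) = Coprime.sym (Coprime.recompute c)

denom-nonZero : ∀ r → NonZero (denom r)
denom-nonZero (ℚ.mkℚ _ _ _) = _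

d-nonZero : ∀ n → NonZero (d n)
d-nonZero n = product-nonZero (primesBelow n)
  where
  factor-nonZero : ∀ q → NonZero (primePowFactor n q)
  factor-nonZero zero    = _
  factor-nonZero (suc q) = m^n≢0 (suc q) (l n (suc q))
  product-nonZero : ∀ ps → NonZero (foldr _*_ 1 (map (primePowFactor n) ps))
  product-nonZero []       = _
  product-nonZero (q ∷ ps) = m*n≢0 (primePowFactor n q) _ {{factor-nonZero q}} {{product-nonZero ps}}

-- Integrality at p says that the denominator divides u N times the numerator; being coprime to the
-- numerator, it divides u N.
denom∣ : ∀ w → 0 < length w → denom (H w) ∣ length w ! * d (length w)
denom∣ w 0<n = ∣-local-global (denom (H w)) N {{denom-nonZero (H w)}} locally
  where
  N = length w ! * d (length w)
  locally : ∀ p → Prime p → ∃ λ u → ¬ (p ∣ u) × denom (H w) ∣ u * N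
  locally zero          pr = contradiction pr ¬prime[0]
  locally (suc zero)    pr = contradiction pr ¬prime[1]
  locally (suc (suc q)) pr = go (LocalSum.H-integral q pr 0<n w refl)
    where
    go : LocalSum._∣ₚ_ q pr 1 (fromℕ N ℚ.* H w) → ∃ λ u → ¬ (2 + q ∣ u) × denom (H w) ∣ u * N
    go (u , a , p∤u , eq) = u , p∤u , Coprime.coprime-divisor (denom-coprime (H w))
      (divides ℤ.∣ + 1 ℤ.* a ∣ (trans (*-comm ℤ.∣ ℚ.↥ H w ∣ (u * N)) (clear-denom N (H w) u (+ 1 ℤ.* a) eq)))

∣bchDenomLcm : ∀ n → 0 < n → n ! * d n ∣ bchDenomLcm n
∣bchDenomLcm n 0<n = ∣-local-global N (bchDenomLcm n) {{m*n≢0 (n !) (d n) {{n !≢0}} {{d-nonZero n}}}} locally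
  where
  N = n ! * d n
  locally : ∀ p → Prime p → ∃ λ u → ¬ (p ∣ u) × N ∣ u * bchDenomLcm n
  locally zero          pr = contradiction pr ¬prime[0]
  locally (suc zero)    pr = contradiction pr ¬prime[1]
  locally (suc (suc q)) pr with 2 + q ≤? n
  ... | no p≰n = N , Construction.∤-small q pr 0<n (≰⇒> p≰n) , m∣m*n (bchDenomLcm n)
  ... | yes p≤n = go (Construction.unit-word q pr 0<n p≤n)
    where
    go : (∃ λ w → length w ≡ n × LocalSum.Unitₚ q pr (fromℕ N ℚ.* H w)) → ∃ λ u → ¬ (2 + q ∣ u)
        × N ∣ u * bchDenomLcm n
    -- The multiplier is the absolute value of a, prime to p because N · H w is a unit: u N times
    -- the numerator of H w equals it times the denominator.
    go (w , refl , u , a , p∤u , p∤a , eq) = ℤ.∣ a ∣ , p∤a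
      , ∣-trans (divides (u * ℤ.∣ ℚ.↥ H w ∣) (trans (sym (clear-denom N (H w) u a eq))
          (solve 3 (λ u N v → u :* N :* v := u :* v :* N) refl u N ℤ.∣ ℚ.↥ H w ∣)))
        (*-monoʳ-∣ ℤ.∣ a ∣ (∈⇒∣lcmList (∈-map⁺ (λ v → denom (coeff v H)) (∈-wordsOfLength w))))
      where open +-*-Solver

theorem1 : (n : ℕ) → 1 ≤ n → bchDenomLcm n ≡ n ! * d n
theorem1 n 1≤n = ∣-antisym
  (lcmList-least (All.map⁺ (All.map (λ { {w} refl → denom∣ w 1≤n }) (wordsOfLength-length n))))
  (∣bchDenomLcm n 1≤n)
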